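{- Let $r\ge 2$ be an integer and $\eta>0$. There exists $n_0=n_0(r,\eta)\in\mathbb N$ such that the following holds for all $n\ge n_0$ divisible by $r$. Suppose $G$ is an $n$-vertex digraph such that for all distinct $x,y\in V(G)$ with $xy\notin E(G)$ we have $d^+_G(x)+d^-_G(y)\ge 2(1-1/r+\eta)n$. Then $G$ contains a $T_r$-factor.
   Context: Digraphs have no loops and at most one edge in each direction between any pair of vertices; $xy$ denotes the edge from $x$ to $y$. $d^+_G(x)$, $d^-_G(x)$ are out- and in-degree. $T_r$ is the transitive tournament on $r$ vertices. A $T_r$-factor is a collection of vertex-disjoint copies of $T_r$ in $G$ covering all vertices. -}

module Defs where

open import Data.Nat using (ℕ; zero; suc; _+_)
open import Data.Bool using (Bool; true; false; if_then_else_)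
open import Data.Fin using (Fin)
open import Data.List using (List; map; allFin)
open import Data.Nat.ListAction using (sum)
open import Data.Product using (_×_; ∃; ∃-syntax; Σ-syntax)
open import Data.Fin using (_<_)
open import Relation.Binary.PropositionalEquality using (_≡_)

record Digraph (n : ℕ) : Set where
  field
    adj      : Fin n → Fin n → Bool
    loopless : ∀ x → adj x x ≡ false
open Digraph public

countV : ∀ {n} → (Fin n → Bool) → ℕ
countV {n} P = sum (map (λ y → if P y then 1 else 0) (allFin n))

outdeg : ∀ {n} → Digraph n → Fin n → ℕ
outdeg G x = countV (λ y → adj G x y)

indeg : ∀ {n} → Digraph n → Fin n → ℕ
indeg G y = countV (λ x → adj G x y)

-- f : Fin r → Fin n is (the vertex map of) a copy of the transitive
-- tournament T_r in G: edges f i → f j for all i < j.  Injectivity is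
-- required at the level of the factor below.
IsTTCopy : ∀ {n} → Digraph n → (r : ℕ) → (Fin r → Fin n) → Set
IsTTCopy G r f = ∀ (i j : Fin r) → i < j → adj G (f i) (f j) ≡ true

HasTTFactor : ∀ {n} → Digraph n → ℕ → Set
HasTTFactor {n} G r =
  Σ[ k ∈ ℕ ] Σ[ F ∈ (Fin k → Fin r → Fin n) ] ((∀ (c : Fin k) → IsTTCopy G r (F c))
    × (∀ (c c' : Fin k) (i i' : Fin r) → F c i ≡ F c' i' → (c ≡ c') × (i ≡ i'))
    × (∀ (v : Fin n) → Σ[ c ∈ Fin k ] Σ[ i ∈ Fin r ] (F c i ≡ v)))

-- Let D⁺, D⁻ be the closed out- and in-degrees in the complement and s = n / r, so that
-- D⁺ x + D⁻ y ≤ 2s - 2rg for non-adjacent x ≠ y, with g linear in n. A copy of T_r is grown by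
-- adding vertices that send edges to, or receive edges from, all vertices chosen so far.
--
-- Light tiles: for every weighting w ≥ 0 some copy T of T_r has s w(T) ≤ w(V). The vertices with
-- D⁺, D⁻ > s form a clique, so either r of them are lighter than average, or, after discarding
-- the few that are, a lightest vertex v has at most s non-neighbours on one side; take v, remove s
-- vertices containing these non-neighbours, and recurse.
--
-- Almost tiling: tiles are removed one by one, keeping all degrees D±(x) into the remaining set
-- close to proportional. The potential is the sum of the squared deviations; its linear change is
-- a weighting of the vertices, for which a light tile is chosen. Only boundedly many vertices
-- ever deviate too much, and they are not used while they do.
--
-- Absorption: vertices with min(D⁺, D⁻) ≤ s - rg can be exchanged for each other through
-- a positive fraction of all (r-1)-tuples, and every other vertex for its non-neighbours, so any u and y are exchanged through a chain of three steps. A block is a copy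
-- y₁ … y_r of T_r with chains prepared for each y_i; each r-tuple of vertices is absorbed by a
-- positive fraction of all blocks. Choosing disjoint blocks one by one, with the weight of an
-- r-tuple doubling whenever it is missed, gives a reservoir in which every r-tuple is absorbed
-- often enough to finish greedily.

module Submission where

open import Defs

module TransitiveTilings where

  import Algebra.Solver.CommutativeMonoid as CommutativeMonoidSolver
  open import Data.Bool using (Bool; true; false; if_then_else_)
  import Data.Bool.Properties as Boolₚ
  open import Data.Empty using (⊥-elim)
  open import Data.Fin using (Fin)
  import Data.Fin.Properties as Finₚ
  import Data.Integer as ℤ
  open ℤ using (ℤ; ∣_∣) renaming (+_ to infix 8 ι_)
  import Data.Integer.Properties as ℤₚ
  import Data.Integer.Tactic.RingSolver as ℤ-Ring
  open import Data.List using (lookup; List; []; _∷_; [_]; _++_; cartesianProductWith; map; length; concat; concatMap; filter; allFin; take; drop)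
  import Data.List.Properties as Listₚ
  import Data.List.Membership.DecPropositional as DecMembership
  open import Data.List.Membership.Propositional using (_∈_; _∉_; find)
  open import Data.List.Membership.Propositional.Properties
    using (∈-cartesianProductWith⁺; ∈-++⁺ˡ; ∈-++⁺ʳ; ∈-++⁻; ∈-allFin; ∈-filter⁺; ∈-filter⁻; ∈-lookup; ∈-∃++)
  open import Data.List.Relation.Binary.Permutation.Propositional
    using (_↭_; ↭-refl; ↭-sym; ↭-trans; ↭-prep; ↭-reflexive; module PermutationReasoning)
  import Data.List.Relation.Binary.Permutation.Propositional as ↭
  import Data.List.Relation.Binary.Permutation.Propositional.Properties as ↭ₚ
  open import Data.List.Relation.Unary.All using (All; []; _∷_)
  import Data.List.Relation.Unary.All as All
  import Data.List.Relation.Unary.All.Properties as Allₚ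
  open import Data.List.Relation.Unary.AllPairs using (AllPairs; []; _∷_)
  import Data.List.Relation.Unary.AllPairs as AllPairs
  import Data.List.Relation.Unary.AllPairs.Properties as AllPairsₚ
  open import Data.List.Relation.Unary.Any using (Any; here; there)
  import Data.List.Relation.Unary.Any as Any
  import Data.List.Relation.Unary.Any.Properties as Anyₚ
  open import Data.List.Relation.Unary.Unique.Propositional using (Unique)
  import Data.List.Relation.Unary.Unique.Propositional.Properties as Uniqueₚ
  open import Data.Nat hiding (∣_-_∣)
  open import Data.Nat.ListAction using (sum)
  open import Data.Nat.Coprimality using (Coprime)
  open import Data.Nat.Divisibility using (_∣_; quotient)
  open import Data.Nat.DivMod using (m≡m%n+[m/n]*n; m%n<n; m/n*n≤m; m*n/n≡m; /-monoˡ-≤)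
  open import Data.Nat.Properties
  open import Data.Nat.Tactic.RingSolver using (solve-∀)
  import Data.Rational as ℚ
  open ℚ using (ℚ; mkℚ)
  import Data.Rational.Properties as ℚₚ
  import Data.Rational.Unnormalised as ℚᵘ
  open ℚᵘ using (mkℚᵘ; _≃_)
  import Data.Rational.Unnormalised.Properties as ℚᵘₚ
  open import Data.Product using (Σ-syntax; ∃-syntax; _×_; _,_; proj₁; proj₂)
  open import Data.Sum using (_⊎_; inj₁; inj₂; [_,_]′)
  open import Data.Unit using (⊤; tt)
  open import Function using (_∘_; id)
  open import Data.Vec using (Vec; []; _∷_; toList)
  import Data.Vec.Properties as Vecₚ
  open import Level using (Level)
  open import Relation.Binary.PropositionalEquality
    using (_≡_; _≢_; refl; sym; trans; cong; cong₂; subst; subst₂; module ≡-Reasoning)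
  open import Relation.Nullary using (¬_; Dec; yes; no; contradiction; _×-dec_; _⊎-dec_; ¬?)
  open import Relation.Nullary.Decidable using (decidable-stable)
  open import Relation.Unary using (Pred; Decidable)

  -- Finite sums, indicator counts and sublists up to permutation.

  private variable
    ℓ ℓ₁ ℓ₂ : Level
    A B C : Set ℓ

  -- Certificates for polynomial inequalities: P ≤ Q collects the hypotheses, with multipliers, and
  -- what remains is a semiring identity without subtraction.
  ≤-by : ∀ {P Q X Y : ℕ} → P ≤ Q → ∀ slack → X + Q + slack ≡ Y + P → X ≤ Y
  ≤-by {P} {Q} {X} {Y} P≤Q slack eq = +-cancelʳ-≤ P X Y (begin
    X + P         ≤⟨ +-monoʳ-≤ X P≤Q ⟩
    X + Q         ≤⟨ m≤m+n (X + Q) slack ⟩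
    X + Q + slack ≡⟨ eq ⟩
    Y + P         ∎)
    where open ≤-Reasoning

  ∑ : List A → (A → ℕ) → ℕ
  ∑ []       f = 0
  ∑ (x ∷ xs) f = f x + ∑ xs f

  ∑-++ : ∀ (xs ys : List A) f → ∑ (xs ++ ys) f ≡ ∑ xs f + ∑ ys f
  ∑-++ []       ys f = refl
  ∑-++ (x ∷ xs) ys f = trans (cong (f x +_) (∑-++ xs ys f)) (sym (+-assoc (f x) _ _))

  ∑-↭ : ∀ {xs ys : List A} f → xs ↭ ys → ∑ xs f ≡ ∑ ys f
  ∑-↭ f ↭.refl = refl
  ∑-↭ f (↭.prep x σ) = cong (f x +_) (∑-↭ f σ)
  ∑-↭ f (↭.swap {xs} {ys} x y σ) =
    trans (cong (λ z → f x + (f y + z)) (∑-↭ f σ)) (swap-+ (f x) (f y) (∑ ys f))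
    where
    swap-+ : ∀ a b c → a + (b + c) ≡ b + (a + c)
    swap-+ = solve-∀
  ∑-↭ f (↭.trans σ τ) = trans (∑-↭ f σ) (∑-↭ f τ)

  ∑-mono : ∀ (xs : List A) {f g} → (∀ {x} → x ∈ xs → f x ≤ g x) → ∑ xs f ≤ ∑ xs g
  ∑-mono []       h = z≤n
  ∑-mono (x ∷ xs) h = +-mono-≤ (h (here refl)) (∑-mono xs (h ∘ there))

  ∑-cong : ∀ (xs : List A) {f g} → (∀ x → f x ≡ g x) → ∑ xs f ≡ ∑ xs g
  ∑-cong []       h = refl
  ∑-cong (x ∷ xs) h = cong₂ _+_ (h x) (∑-cong xs h)

  ∑-const : ∀ (xs : List A) c → ∑ xs (λ _ → c) ≡ length xs * c
  ∑-const []       c = refl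
  ∑-const (x ∷ xs) c = cong (c +_) (∑-const xs c)

  ∑-*ˡ : ∀ (xs : List A) c f → ∑ xs (λ x → c * f x) ≡ c * ∑ xs f
  ∑-*ˡ []       c f = sym (*-zeroʳ c)
  ∑-*ˡ (x ∷ xs) c f = trans (cong (c * f x +_) (∑-*ˡ xs c f)) (sym (*-distribˡ-+ c _ _))

  ∑-+ : ∀ (xs : List A) f g → ∑ xs (λ x → f x + g x) ≡ ∑ xs f + ∑ xs g
  ∑-+ []       f g = refl
  ∑-+ (x ∷ xs) f g =
    trans (cong (f x + g x +_) (∑-+ xs f g)) (exchange (f x) (g x) (∑ xs f) (∑ xs g))
    where
    exchange : ∀ a b c d → a + b + (c + d) ≡ a + c + (b + d)
    exchange = solve-∀

  ∑-comm : ∀ (xs : List A) (ys : List B) (f : A → B → ℕ) →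
    ∑ xs (λ x → ∑ ys (f x)) ≡ ∑ ys (λ y → ∑ xs (λ x → f x y))
  ∑-comm []       ys f = sym (trans (∑-const ys 0) (*-zeroʳ (length ys)))
  ∑-comm (x ∷ xs) ys f =
    trans (cong (∑ ys (f x) +_) (∑-comm xs ys f)) (sym (∑-+ ys (f x) _))

  ∈-∑ : ∀ {xs : List A} {x} f → x ∈ xs → f x ≤ ∑ xs f
  ∈-∑ f (here refl) = m≤m+n _ _
  ∈-∑ f (there x∈)  = ≤-trans (∈-∑ f x∈) (m≤n+m _ _)

  ∑-positive : ∀ (xs : List A) f → 0 < ∑ xs f → ∃[ x ] x ∈ xs × 0 < f x
  ∑-positive (x ∷ xs) f pos with f x in eq
  ... | suc _ = x , here refl , subst (0 <_) (sym eq) z<s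
  ... | zero  with ∑-positive xs f pos
  ...   | y , y∈ , fy = y , there y∈ , fy

  maximum : ∀ (xs : List A) (f : A → ℕ) → 0 < length xs →
    ∃[ x ] x ∈ xs × (∀ {y} → y ∈ xs → f y ≤ f x)
  maximum (x ∷ [])     f _ = x , here refl , λ { (here refl) → ≤-refl }
  maximum (x ∷ y ∷ xs) f _ with maximum (y ∷ xs) f z<s
  ... | m , m∈ , max with ≤-total (f x) (f m)
  ...   | inj₁ fx≤fm = m , there m∈ , λ { (here refl) → fx≤fm ; (there z∈) → max z∈ }
  ...   | inj₂ fm≤fx = x , here refl , λ { (here refl) → ≤-refl ; (there z∈) → ≤-trans (max z∈) fm≤fx }

  minimum : ∀ (xs : List A) (f : A → ℕ) → 0 < length xs →
    ∃[ x ] x ∈ xs × (∀ {y} → y ∈ xs → f x ≤ f y)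
  minimum (x ∷ [])     f _ = x , here refl , λ { (here refl) → ≤-refl }
  minimum (x ∷ y ∷ xs) f _ with minimum (y ∷ xs) f z<s
  ... | m , m∈ , min with ≤-total (f x) (f m)
  ...   | inj₁ fx≤fm = x , here refl , λ { (here refl) → ≤-refl ; (there z∈) → ≤-trans fx≤fm (min z∈) }
  ...   | inj₂ fm≤fx = m , there m∈ , λ { (here refl) → fm≤fx ; (there z∈) → min z∈ }

  ⟦_⟧ : {P : Set ℓ₁} → Dec P → ℕ
  ⟦ yes _ ⟧ = 1
  ⟦ no  _ ⟧ = 0

  ⟦⟧≤1 : {P : Set ℓ₁} (P? : Dec P) → ⟦ P? ⟧ ≤ 1
  ⟦⟧≤1 (yes _) = ≤-refl
  ⟦⟧≤1 (no _)  = z≤n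

  ⟦⟧-true : {P : Set ℓ₁} (P? : Dec P) → P → ⟦ P? ⟧ ≡ 1
  ⟦⟧-true (yes _) _ = refl
  ⟦⟧-true (no ¬p) p = contradiction p ¬p

  ⟦⟧-mono : {P : Set ℓ₁} {Q : Set ℓ₂} (P? : Dec P) (Q? : Dec Q) → (P → Q) → ⟦ P? ⟧ ≤ ⟦ Q? ⟧
  ⟦⟧-mono (no _)  Q? f = z≤n
  ⟦⟧-mono (yes p) Q? f = ≤-reflexive (sym (⟦⟧-true Q? (f p)))

  ⟦⟧-positive : {P : Set ℓ₁} (P? : Dec P) → 0 < ⟦ P? ⟧ → P
  ⟦⟧-positive (yes p) _ = p

  module _ {P : Pred A ℓ₁} (P? : Decidable P) where

    length-filter : ∀ xs → length (filter P? xs) ≡ ∑ xs (λ x → ⟦ P? x ⟧)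
    length-filter [] = refl
    length-filter (x ∷ xs) with P? x
    ... | yes _ = cong suc (length-filter xs)
    ... | no  _ = length-filter xs

    ↭-partition : ∀ xs → xs ↭ filter P? xs ++ filter (¬? ∘ P?) xs
    ↭-partition [] = ↭-refl
    ↭-partition (x ∷ xs) with P? x
    ... | yes _ = ↭-prep x (↭-partition xs)
    ... | no  _ = ↭-trans (↭-prep x (↭-partition xs)) (↭-sym (↭ₚ.shift x (filter P? xs) _))

  ∈-↭ : ∀ {x} {xs : List A} → x ∈ xs → ∃[ ys ] xs ↭ x ∷ ys
  ∈-↭ {x = x} x∈ with ∈-∃++ x∈
  ... | us , vs , refl = us ++ vs , ↭ₚ.shift x us vs

  Unique-↭ : ∀ {xs ys : List A} → xs ↭ ys → Unique xs → Unique ys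
  Unique-↭ ↭.refl u = u
  Unique-↭ (↭.prep x σ) (x∉ ∷ u) = ↭ₚ.All-resp-↭ σ x∉ ∷ Unique-↭ σ u
  Unique-↭ (↭.swap x y σ) ((x≢y ∷ x∉) ∷ y∉ ∷ u) =
    ((x≢y ∘ sym) ∷ ↭ₚ.All-resp-↭ σ y∉) ∷ ↭ₚ.All-resp-↭ σ x∉ ∷ Unique-↭ σ u
  Unique-↭ (↭.trans σ τ) u = Unique-↭ τ (Unique-↭ σ u)

  Unique-++⁻ʳ : ∀ (xs : List A) {ys} → Unique (xs ++ ys) → Unique ys
  Unique-++⁻ʳ []       u       = u
  Unique-++⁻ʳ (x ∷ xs) (_ ∷ u) = Unique-++⁻ʳ xs u

  -- Inclusion of multisets. The complement `Z` is part of the witness, so vertices that are set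
  -- aside stay accounted for.
  _⊑_ : List A → List A → Set _
  Y ⊑ X = ∃[ Z ] X ↭ Y ++ Z

  ⊑-refl : ∀ {X : List A} → X ⊑ X
  ⊑-refl {X = X} = [] , ↭-reflexive (sym (Listₚ.++-identityʳ X))

  ⊑-trans : ∀ {X Y Z : List A} → Z ⊑ Y → Y ⊑ X → Z ⊑ X
  ⊑-trans {Z = Z} (R , σ) (S , τ) =
    R ++ S , ↭-trans τ (↭-trans (↭ₚ.++⁺ʳ S σ) (↭-reflexive (Listₚ.++-assoc Z R S)))

  ⊑-∈ : ∀ {X Y : List A} {x} → Y ⊑ X → x ∈ Y → x ∈ X
  ⊑-∈ (_ , σ) x∈ = ↭ₚ.∈-resp-↭ (↭-sym σ) (∈-++⁺ˡ x∈)

  ⊑-Unique : ∀ {X Y : List A} → Y ⊑ X → Unique X → Unique Y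
  ⊑-Unique {Y = Y} (Z , σ) u = Unique-++⁻ʳ Z (Unique-↭ (↭-trans σ (↭ₚ.++-comm Y Z)) u)

  ⊑-∑ : ∀ {X Y : List A} f → Y ⊑ X → ∑ Y f ≤ ∑ X f
  ⊑-∑ {X = X} {Y} f (Z , σ) = begin
    ∑ Y f         ≤⟨ m≤m+n _ _ ⟩
    ∑ Y f + ∑ Z f ≡⟨ ∑-++ Y Z f ⟨
    ∑ (Y ++ Z) f  ≡⟨ ∑-↭ f σ ⟨
    ∑ X f         ∎
    where open ≤-Reasoning

  ⊑-filter : {P : Pred A ℓ₁} (P? : Decidable P) (X : List A) → filter P? X ⊑ X
  ⊑-filter P? X = _ , ↭-partition P? X

  length-partition : {P : Pred A ℓ₁} (P? : Decidable P) (X : List A) →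
    length X ≡ length (filter P? X) + length (filter (¬? ∘ P?) X)
  length-partition P? X =
    trans (↭ₚ.↭-length (↭-partition P? X)) (Listₚ.length-++ (filter P? X))

  ∑-map : ∀ (f : A → B) (xs : List A) h → ∑ (map f xs) h ≡ ∑ xs (h ∘ f)
  ∑-map f []       h = refl
  ∑-map f (x ∷ xs) h = cong (h (f x) +_) (∑-map f xs h)

  -- Room for the light vertices of the clique Big X s, fewer than k of which are discarded when
  -- looking for k vertices.
  slack : ℕ → ℕ
  slack zero    = 0
  slack (suc k) = slack k + k

  -- Cones, tiles and the existence of light tiles.

  module Cones {n : ℕ} (G : Digraph n) where

    open CommutativeMonoidSolver (↭ₚ.++-commutativeMonoid {A = Fin n}) public
      using (_⊕_; _⊜_) renaming (solve to ↭-solve)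

    infix 4 _⟶_ _⟶?_

    _⟶_ : Fin n → Fin n → Set
    x ⟶ y = adj G x y ≡ true

    _⟶?_ : ∀ x y → Dec (x ⟶ y)
    x ⟶? y = adj G x y Boolₚ.≟ true

    irreflexive : ∀ {x} → ¬ x ⟶ x
    irreflexive {x} x⟶x with trans (sym x⟶x) (loopless G x)
    ... | ()

    -- Closed degrees in the complement: since G is loopless, a vertex of X counts itself.
    D⁺ D⁻ : List (Fin n) → Fin n → ℕ
    D⁺ X x = ∑ X (λ y → ⟦ ¬? (x ⟶? y) ⟧)
    D⁻ X y = ∑ X (λ x → ⟦ ¬? (x ⟶? y) ⟧)

    -- The degree condition in the complement: lower bounds on degrees become upper bounds, which
    -- pass to every subset of `X`.
    Ore : List (Fin n) → ℕ → Set
    Ore X m = ∀ {x y} → x ∈ X → y ∈ X → x ≢ y → ¬ x ⟶ y → D⁺ X x + D⁻ X y ≤ m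

    ⊑-Ore : ∀ {X Y m} → Y ⊑ X → Ore X m → Ore Y m
    ⊑-Ore Y⊑X ore x∈ y∈ x≢y x↛y =
      ≤-trans (+-mono-≤ (⊑-∑ _ Y⊑X) (⊑-∑ _ Y⊑X)) (ore (⊑-∈ Y⊑X x∈) (⊑-∈ Y⊑X y∈) x≢y x↛y)

    Attach : Fin n → List (Fin n) → Set
    Attach v l = All (v ⟶_) l ⊎ All (_⟶ v) l

    Attach? : ∀ v l → Dec (Attach v l)
    Attach? v l = All.all? (v ⟶?_) l ⊎-dec All.all? (_⟶? v) l

    -- A transitive tournament in its order of construction: each vertex is a source or a sink over
    -- the vertices after it. A greedy choice may thus use whichever side has few non-neighbours.
    Cone : List (Fin n) → Set
    Cone []      = ⊤
    Cone (v ∷ l) = Attach v l × Cone l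

    Cone? : ∀ l → Dec (Cone l)
    Cone? []      = yes tt
    Cone? (v ∷ l) = Attach? v l ×-dec Cone? l

    Transitive : List (Fin n) → Set
    Transitive = AllPairs _⟶_

    -- A source goes to the front of the linear order and a sink to its back.
    Cone⇒Transitive : ∀ l → Cone l → ∃[ l′ ] Transitive l′ × l′ ↭ l
    Cone⇒Transitive []      _ = [] , [] , ↭-refl
    Cone⇒Transitive (v ∷ l) (att , c) with Cone⇒Transitive l c
    Cone⇒Transitive (v ∷ l) (inj₁ out , c) | l′ , tr , σ =
      v ∷ l′ , ↭ₚ.All-resp-↭ (↭-sym σ) out ∷ tr , ↭-prep v σ
    Cone⇒Transitive (v ∷ l) (inj₂ inn , c) | l′ , tr , σ =
      l′ ++ [ v ] ,
      AllPairsₚ.++⁺ tr ([] ∷ []) (All.map (_∷ []) (↭ₚ.All-resp-↭ (↭-sym σ) inn)) ,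
      ↭-trans (↭ₚ.++-comm l′ [ v ]) (↭-prep v σ)

    Attach⇒∉ : ∀ {v l} → Attach v l → v ∉ l
    Attach⇒∉ (inj₁ out) v∈ = irreflexive (All.lookup out v∈)
    Attach⇒∉ (inj₂ inn) v∈ = irreflexive (All.lookup inn v∈)

    Cone⇒Unique : ∀ l → Cone l → Unique l
    Cone⇒Unique []      _ = []
    Cone⇒Unique (v ∷ l) (att , c) =
      Allₚ.¬Any⇒All¬ l (Attach⇒∉ att) ∷ Cone⇒Unique l c

    clique⇒Cone : ∀ l → Unique l → (∀ {x y} → x ∈ l → y ∈ l → x ≢ y → x ⟶ y) → Cone l
    clique⇒Cone []      _        _  = tt
    clique⇒Cone (v ∷ l) (v∉ ∷ u) cl =
      inj₁ (All.tabulate λ y∈ → cl (here refl) (there y∈) (All.lookup v∉ y∈)) ,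
      clique⇒Cone l u (λ x∈ y∈ → cl (there x∈) (there y∈))

    Tile : ℕ → List (Fin n) → Set
    Tile r l = length l ≡ r × Transitive l

    -- The permutation expresses covering, and, when `X` has no repetitions, also disjointness of
    -- the tiles.
    Tileable : ℕ → List (Fin n) → Set
    Tileable r X = ∃[ ts ] All (Tile r) ts × concat ts ↭ X

    Tileable-[] : ∀ {r} → Tileable r []
    Tileable-[] = [] , [] , ↭-refl

    Tileable-↭ : ∀ {r X Y} → X ↭ Y → Tileable r X → Tileable r Y
    Tileable-↭ σ (ts , tiles , τ) = ts , tiles , ↭-trans τ σ

    Tileable-++ : ∀ {r X Y} → Tileable r X → Tileable r Y → Tileable r (X ++ Y)
    Tileable-++ (ts , tiles , σ) (us , tiles′ , τ) =
      ts ++ us , Allₚ.++⁺ tiles tiles′ ,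
      ↭-trans (↭-reflexive (sym (Listₚ.concat-++ ts us))) (↭ₚ.++⁺ σ τ)

    Cone⇒Tileable : ∀ {r} l → length l ≡ r → Cone l → Tileable r l
    Cone⇒Tileable l eq c with Cone⇒Transitive l c
    ... | l′ , tr , σ = [ l′ ] , (trans (↭ₚ.↭-length σ) eq , tr) ∷ [] ,
                        ↭-trans (↭-reflexive (Listₚ.++-identityʳ l′)) σ

    Big : List (Fin n) → ℕ → Fin n → Set
    Big X s x = s < D⁺ X x × s < D⁻ X x

    Big? : ∀ X s x → Dec (Big X s x)
    Big? X s x = (s <? D⁺ X x) ×-dec (s <? D⁻ X x)

    -- Without the edge, `D⁺ X x + D⁻ X y` would exceed `2 * s`. Exchanging the roles of `x` and `y`
    -- gives the other edge, so big vertices form a clique.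
    Big-adjacent : ∀ {X s x y} → Ore X (2 * s) → x ∈ X → y ∈ X → x ≢ y →
      Big X s x → Big X s y → x ⟶ y
    Big-adjacent {X} {s} {x} {y} ore x∈ y∈ x≢y (s<x , _) (_ , s<y) =
      decidable-stable (x ⟶? y) λ x↛y → <-irrefl refl (begin-strict
        2 * s             ≡⟨ cong (s +_) (+-identityʳ s) ⟩
        s + s             <⟨ +-mono-< s<x s<y ⟩
        D⁺ X x + D⁻ X y   ≤⟨ ore x∈ y∈ x≢y x↛y ⟩
        2 * s             ∎)
      where open ≤-Reasoning

    -- If `X` has `k * s` vertices, the last condition says that `T` weighs no more than `k` average
    -- vertices.
    LightCone : ℕ → ℕ → List (Fin n) → (Fin n → ℕ) → Set
    LightCone k s X w = ∃[ T ] T ⊑ X × Cone T × length T ≡ k × s * ∑ T w ≤ ∑ X w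

    -- The greedy step: v pays for s vertices, all at least as heavy, that include its non-neighbours.
    extend : ∀ {k s} X X₁ F (w : Fin n → ℕ) v {P : Fin n → Set} (P? : Decidable P) →
      X ↭ F ++ X₁ → v ∈ X₁ → (∀ {y} → y ∈ X₁ → w v ≤ w y) →
      ¬ P v → (∀ {l} → All P l → Attach v l) → ∑ X (λ y → ⟦ ¬? (P? y) ⟧) ≤ s →
      s ≤ length X₁ →
      (∀ X₃ → X₃ ⊑ X → length X₁ ≤ s + length X₃ → LightCone k s X₃ w) →
      LightCone (suc k) s X w
    extend {k} {s} X X₁ F w v P? X↭ v∈ v-min ¬Pv attach ∑≤s s≤ rec =
      v ∷ T ,
      (R ++ pad ++ N′ ++ F , perm) ,
      (attach (All.tabulate λ x∈ → proj₂ (∈-filter⁻ P? {xs = X₁} (X₃⊆X₂ (⊑-∈ T⊑X₃ x∈)))) , cone) ,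
      cong suc len , weight
      where
      X₂ = filter P? X₁
      N  = filter (¬? ∘ P?) X₁
      N≤s : length N ≤ s
      N≤s = ≤-trans (≤-reflexive (length-filter (¬? ∘ P?) X₁))
                    (≤-trans (⊑-∑ _ (F , ↭-trans X↭ (↭ₚ.++-comm F X₁))) ∑≤s)
      -- Padding brings the discarded set to exactly `s` vertices, none lighter than `v`, so it
      -- carries weight at least `s * w v`.
      d   = s ∸ length N
      pad = take d X₂
      X₃  = drop d X₂
      -- As `v` counts among its own non-neighbours, it leaves together with them and cannot be
      -- chosen again.
      v∈N : v ∈ N
      v∈N = ∈-filter⁺ (¬? ∘ P?) v∈ ¬Pv
      N′   = proj₁ (∈-↭ v∈N)
      N↭   = proj₂ (∈-↭ v∈N)
      X₃⊆X₂ : ∀ {x} → x ∈ X₃ → x ∈ X₂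
      X₃⊆X₂ x∈ = subst (_ ∈_) (Listₚ.take++drop≡id d X₂) (∈-++⁺ʳ pad x∈)
      X₁↭ : X₁ ↭ X₃ ++ (N ++ pad)
      X₁↭ = begin
        X₁                 ↭⟨ ↭-partition P? X₁ ⟩
        X₂ ++ N            ≡⟨ cong (_++ N) (Listₚ.take++drop≡id d X₂) ⟨
        (pad ++ X₃) ++ N   ↭⟨ ↭-solve 3 (λ p x m → (p ⊕ x) ⊕ m ⊜ x ⊕ (m ⊕ p)) ↭-refl pad X₃ N ⟩
        X₃ ++ (N ++ pad)   ∎
        where open PermutationReasoning
      X₃⊑X : X₃ ⊑ X
      X₃⊑X = ⊑-trans (N ++ pad , X₁↭) (F , ↭-trans X↭ (↭ₚ.++-comm F X₁))
      d≤X₂ : d ≤ length X₂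
      d≤X₂ = m≤n+o⇒m∸n≤o s (length N) (≤-trans s≤ (≤-reflexive
        (trans (length-partition P? X₁) (+-comm (length X₂) _))))
      N+pad : length (N ++ pad) ≡ s
      N+pad = begin
        length (N ++ pad)       ≡⟨ Listₚ.length-++ N ⟩
        length N + length pad   ≡⟨ cong (length N +_) (trans (Listₚ.length-take d X₂) (m≤n⇒m⊓n≡m d≤X₂)) ⟩
        length N + d            ≡⟨ m+[n∸m]≡n N≤s ⟩
        s                       ∎
        where open ≡-Reasoning
      X₁≤ : length X₁ ≤ s + length X₃
      X₁≤ = ≤-reflexive (begin
        length X₁                        ≡⟨ ↭ₚ.↭-length X₁↭ ⟩
        length (X₃ ++ (N ++ pad))        ≡⟨ Listₚ.length-++ X₃ ⟩
        length X₃ + length (N ++ pad)    ≡⟨ cong (length X₃ +_) N+pad ⟩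
        length X₃ + s                    ≡⟨ +-comm (length X₃) s ⟩
        s + length X₃                    ∎)
        where open ≡-Reasoning
      ih     = rec X₃ X₃⊑X X₁≤
      T      = proj₁ ih
      T⊑X₃   = proj₁ (proj₂ ih)
      R      = proj₁ T⊑X₃
      cone   = proj₁ (proj₂ (proj₂ ih))
      len    = proj₁ (proj₂ (proj₂ (proj₂ ih)))
      light  = proj₂ (proj₂ (proj₂ (proj₂ ih)))
      perm : X ↭ v ∷ T ++ (R ++ pad ++ N′ ++ F)
      perm = begin
        X                                    ↭⟨ X↭ ⟩
        F ++ X₁                              ↭⟨ ↭ₚ.++⁺ˡ F X₁↭ ⟩
        F ++ X₃ ++ N ++ pad                  ↭⟨ ↭ₚ.++⁺ˡ F (↭ₚ.++⁺ (proj₂ T⊑X₃) (↭ₚ.++⁺ʳ pad N↭)) ⟩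
        F ++ (T ++ R) ++ ([ v ] ++ N′) ++ pad
          ↭⟨ ↭-solve 6 (λ f t r v n p → f ⊕ (t ⊕ r) ⊕ (v ⊕ n) ⊕ p ⊜ v ⊕ t ⊕ r ⊕ p ⊕ n ⊕ f) ↭-refl F T R [ v ] N′ pad ⟩
        [ v ] ++ T ++ R ++ pad ++ N′ ++ F    ∎
        where open PermutationReasoning
      weight : s * (w v + ∑ T w) ≤ ∑ X w
      weight = begin
        s * (w v + ∑ T w)            ≡⟨ *-distribˡ-+ s (w v) (∑ T w) ⟩
        s * w v + s * ∑ T w          ≡⟨ cong (λ l → l * w v + s * ∑ T w) N+pad ⟨
        length (N ++ pad) * w v + s * ∑ T w
          ≡⟨ cong (_+ s * ∑ T w) (∑-const (N ++ pad) (w v)) ⟨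
        ∑ (N ++ pad) (λ _ → w v) + s * ∑ T w
          ≤⟨ +-mono-≤ (∑-mono (N ++ pad) λ x∈ → v-min (↭ₚ.∈-resp-↭ (↭-sym X₁↭) (∈-++⁺ʳ X₃ x∈))) light ⟩
        ∑ (N ++ pad) w + ∑ X₃ w      ≡⟨ +-comm (∑ (N ++ pad) w) _ ⟩
        ∑ X₃ w + ∑ (N ++ pad) w      ≡⟨ ∑-++ X₃ (N ++ pad) w ⟨
        ∑ (X₃ ++ (N ++ pad)) w       ≡⟨ ∑-↭ w X₁↭ ⟨
        ∑ X₁ w                       ≤⟨ m≤n+m _ _ ⟩
        ∑ F w + ∑ X₁ w               ≡⟨ ∑-++ F X₁ w ⟨
        ∑ (F ++ X₁) w                ≡⟨ ∑-↭ w X↭ ⟨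
        ∑ X w                        ∎
        where open ≤-Reasoning

    -- Induction on `k` with `s` fixed: each greedy step costs `s` vertices and at most `k`
    -- discarded light ones, and the Ore bound is inherited by what remains.
    light-cone : ∀ k s X w → 0 < s → Unique X → k * s + slack k ≤ length X →
      Ore X (2 * s) → LightCone k s X w
    light-cone zero    s X w _   _ _    _   =
      [] , (X , ↭-refl) , tt , refl , ≤-trans (≤-reflexive (*-zeroʳ s)) z≤n
    light-cone (suc k) s X w 0<s u size ore = split (suc k ≤? length F)
      where
      W = ∑ X w
      -- The threshold `W / (suc k * s)` is at least the average weight, since `X` has at least
      -- `suc k * s` vertices; `suc k` light vertices together weigh at most `W / s`.
      Light : Fin n → Set
      Light x = w x * (suc k * s) ≤ W
      BL? : ∀ x → Dec (Big X s x × Light x)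
      BL? x = Big? X s x ×-dec (w x * (suc k * s) ≤? W)
      F  = filter BL? X
      X₁ = filter (¬? ∘ BL?) X
      X↭ : X ↭ F ++ X₁
      X↭ = ↭-partition BL? X

      clique : suc k ≤ length F → LightCone (suc k) s X w
      clique k<F = T , T⊑X , cone , len ,
        *-cancelˡ-≤ (suc k) (begin
          suc k * (s * ∑ T w)               ≡⟨ *-assoc (suc k) s _ ⟨
          suc k * s * ∑ T w                 ≡⟨ ∑-*ˡ T (suc k * s) w ⟨
          ∑ T (λ x → suc k * s * w x)       ≤⟨ ∑-mono T (λ {x} x∈ →
            ≤-trans (≤-reflexive (*-comm (suc k * s) (w x))) (proj₂ (props (∈T⇒∈F x∈)))) ⟩
          ∑ T (λ _ → W)                     ≡⟨ ∑-const T W ⟩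
          length T * W                      ≡⟨ cong (_* W) len ⟩
          suc k * W                         ∎)
        where
        open ≤-Reasoning
        T = take (suc k) F
        F≡ = Listₚ.take++drop≡id (suc k) F
        T⊑X : T ⊑ X
        T⊑X = ⊑-trans (drop (suc k) F , ↭-reflexive (sym F≡)) (X₁ , X↭)
        len : length T ≡ suc k
        len = trans (Listₚ.length-take (suc k) F) (m≤n⇒m⊓n≡m k<F)
        ∈T⇒∈F : ∀ {x} → x ∈ T → x ∈ F
        ∈T⇒∈F x∈ = subst (_ ∈_) F≡ (∈-++⁺ˡ x∈)
        props : ∀ {x} → x ∈ F → Big X s x × Light x
        props x∈ = proj₂ (∈-filter⁻ BL? {xs = X} x∈)
        cone : Cone T
        cone = clique⇒Cone T (⊑-Unique T⊑X u) λ x∈ y∈ x≢y →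
          Big-adjacent ore (⊑-∈ T⊑X x∈) (⊑-∈ T⊑X y∈) x≢y
            (proj₁ (props (∈T⇒∈F x∈))) (proj₁ (props (∈T⇒∈F y∈)))

      greedy : length F ≤ k → LightCone (suc k) s X w
      greedy F≤k = choose (D⁺ X v ≤? s) (D⁻ X v ≤? s)
        where
        open ≤-Reasoning
        X₁≥ : suc k * s + slack k ≤ length X₁
        X₁≥ = +-cancelˡ-≤ k _ _ (begin
          k + (suc k * s + slack k)   ≡⟨ +-comm k _ ⟩
          suc k * s + slack k + k     ≡⟨ +-assoc (suc k * s) _ _ ⟩
          suc k * s + slack (suc k)   ≤⟨ size ⟩
          length X                    ≡⟨ length-partition BL? X ⟩
          length F + length X₁        ≤⟨ +-monoˡ-≤ _ F≤k ⟩
          k + length X₁               ∎)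
        s≤X₁ : s ≤ length X₁
        s≤X₁ = ≤-trans (≤-trans (m≤m+n s (k * s)) (m≤m+n _ _)) X₁≥
        lightest = minimum X₁ w (≤-trans 0<s s≤X₁)
        v     = proj₁ lightest
        v∈    = proj₁ (proj₂ lightest)
        v-min = proj₂ (proj₂ lightest)
        -- Otherwise v, and hence every vertex of X₁, would be heavier than average.
        ¬Big : ¬ Big X s v
        ¬Big big = proj₂ (∈-filter⁻ (¬? ∘ BL?) {xs = X} v∈) (big , (begin
          w v * (suc k * s)         ≤⟨ *-monoʳ-≤ (w v) (≤-trans (m≤m+n _ _) X₁≥) ⟩
          w v * length X₁           ≡⟨ *-comm (w v) _ ⟩
          length X₁ * w v           ≡⟨ ∑-const X₁ (w v) ⟨
          ∑ X₁ (λ _ → w v)          ≤⟨ ∑-mono X₁ v-min ⟩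
          ∑ X₁ w                    ≤⟨ ⊑-∑ w (⊑-filter (¬? ∘ BL?) X) ⟩
          W                         ∎))
        rec : ∀ X₃ → X₃ ⊑ X → length X₁ ≤ s + length X₃ → LightCone k s X₃ w
        rec X₃ X₃⊑X X₁≤ = light-cone k s X₃ w 0<s (⊑-Unique X₃⊑X u)
          (+-cancelˡ-≤ s _ _ (≤-trans (≤-trans (≤-reflexive (sym (+-assoc s (k * s) _))) X₁≥) X₁≤))
          (⊑-Ore X₃⊑X ore)
        choose : Dec (D⁺ X v ≤ s) → Dec (D⁻ X v ≤ s) → LightCone (suc k) s X w
        choose (yes d≤s) _         =
          extend X X₁ F w v (v ⟶?_) X↭ v∈ v-min irreflexive inj₁ d≤s s≤X₁ rec
        choose (no _)    (yes d≤s) =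
          extend X X₁ F w v (_⟶? v) X↭ v∈ v-min irreflexive inj₂ d≤s s≤X₁ rec
        choose (no d≰s)  (no d′≰s) = ⊥-elim (¬Big (≰⇒> d≰s , ≰⇒> d′≰s))

      split : Dec (suc k ≤ length F) → LightCone (suc k) s X w
      split (yes k<F) = clique k<F
      split (no  k≮F) = greedy (s≤s⁻¹ (≰⇒> k≮F))

  -- A quadratic potential for simultaneous deviations.

  module Discrepancy {A I : Set} (tests : List I) (χ : I → A → ℕ)
                     (χ≤1 : ∀ i v → χ i v ≤ 1) (X₀ : List A) where

    p₀ : ℕ
    p₀ = length X₀

    -- The deviation of X from a typical subset of X₀ on test i, scaled by p₀. It is additive in X,
    -- so φ is the square of a Euclidean norm with inner product pair tests.
    e : I → List A → ℤ
    e i X = ι (p₀ * ∑ X (χ i)) ℤ.- ι (length X * ∑ X₀ (χ i))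

    pair : List I → List A → List A → ℤ
    pair []       X Y = ι 0
    pair (i ∷ is) X Y = e i X ℤ.* e i Y ℤ.+ pair is X Y

    φ : List A → ℕ
    φ X = ∑ tests (λ i → ∣ e i X ∣ * ∣ e i X ∣)

    e-++ : ∀ i X Y → e i (X ++ Y) ≡ e i X ℤ.+ e i Y
    e-++ i X Y = begin
      ι (p₀ * ∑ (X ++ Y) (χ i)) ℤ.- ι (length (X ++ Y) * a)
        ≡⟨ cong₂ (λ s l → ι (p₀ * s) ℤ.- ι (l * a)) (∑-++ X Y (χ i)) (Listₚ.length-++ X) ⟩
      ι (p₀ * (x + y)) ℤ.- ι ((k + l) * a)
        ≡⟨ cong₂ (λ s t → ι s ℤ.- ι t) (*-distribˡ-+ p₀ x y) (*-distribʳ-+ a k l) ⟩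
      (ι (p₀ * x) ℤ.+ ι (p₀ * y)) ℤ.- (ι (k * a) ℤ.+ ι (l * a))
        ≡⟨ interchange (ι (p₀ * x)) (ι (p₀ * y)) (ι (k * a)) (ι (l * a)) ⟩
      e i X ℤ.+ e i Y ∎
      where
      open ≡-Reasoning
      a = ∑ X₀ (χ i)
      x = ∑ X (χ i)
      y = ∑ Y (χ i)
      k = length X
      l = length Y
      interchange : ∀ a b c d → (a ℤ.+ b) ℤ.- (c ℤ.+ d) ≡ (a ℤ.- c) ℤ.+ (b ℤ.- d)
      interchange = ℤ-Ring.solve-∀

    e-↭ : ∀ i {X Y} → X ↭ Y → e i X ≡ e i Y
    e-↭ i σ = cong₂ (λ s l → ι (p₀ * s) ℤ.- ι (l * ∑ X₀ (χ i))) (∑-↭ (χ i) σ) (↭ₚ.↭-length σ)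

    ∑χ≤length : ∀ i X → ∑ X (χ i) ≤ length X
    ∑χ≤length i X = begin
      ∑ X (χ i)         ≤⟨ ∑-mono X (λ {v} _ → χ≤1 i v) ⟩
      ∑ X (λ _ → 1)     ≡⟨ ∑-const X 1 ⟩
      length X * 1      ≡⟨ *-identityʳ _ ⟩
      length X          ∎
      where open ≤-Reasoning

    ∣e∣≤ : ∀ i X → ∣ e i X ∣ ≤ length X * p₀
    ∣e∣≤ i X = begin
      ∣ e i X ∣                                       ≡⟨ cong ∣_∣ (ℤₚ.m-n≡m⊖n (p₀ * ∑ X (χ i)) (length X * ∑ X₀ (χ i))) ⟩
      ∣ (p₀ * ∑ X (χ i)) ℤ.⊖ (length X * ∑ X₀ (χ i)) ∣  ≤⟨ ℤₚ.∣m⊝n∣≤m⊔n (p₀ * ∑ X (χ i)) _ ⟩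
      (p₀ * ∑ X (χ i)) ⊔ (length X * ∑ X₀ (χ i))
        ≤⟨ ⊔-lub (≤-trans (*-monoʳ-≤ p₀ (∑χ≤length i X)) (≤-reflexive (*-comm p₀ _)))
                 (*-monoʳ-≤ (length X) (∑χ≤length i X₀)) ⟩
      length X * p₀                                   ∎
      where open ≤-Reasoning

    -- Crude, but applied to a single tile it gives the quadratic error of one removal.
    φ-bound : ∀ X → φ X ≤ length tests * ((length X * p₀) * (length X * p₀))
    φ-bound X = ≤-trans (∑-mono tests (λ {i} _ → *-mono-≤ (∣e∣≤ i X) (∣e∣≤ i X)))
                        (≤-reflexive (∑-const tests _))

    φ-initial : φ X₀ ≡ 0
    φ-initial = trans (∑-cong tests (λ i → cong (λ z → ∣ z ∣ * ∣ z ∣) (ℤₚ.+-inverseʳ (ι (p₀ * ∑ X₀ (χ i))))))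
                      (trans (∑-const tests 0) (*-zeroʳ (length tests)))

    ∣i∣²≡i² : ∀ i → ι (∣ i ∣ * ∣ i ∣) ≡ i ℤ.* i
    ∣i∣²≡i² (ι n)      = ℤₚ.pos-* n n
    ∣i∣²≡i² ℤ.-[1+ n ] = refl

    φ≡pair : ∀ X → ι φ X ≡ pair tests X X
    φ≡pair X = go tests
      where
      go : ∀ is → ι ∑ is (λ i → ∣ e i X ∣ * ∣ e i X ∣) ≡ pair is X X
      go []       = refl
      go (i ∷ is) = cong₂ ℤ._+_ (∣i∣²≡i² (e i X)) (go is)

    pair-++ : ∀ is X Y Z → pair is X (Y ++ Z) ≡ pair is X Y ℤ.+ pair is X Z
    pair-++ []       X Y Z = refl
    pair-++ (i ∷ is) X Y Z = trans
      (cong₂ (λ s t → e i X ℤ.* s ℤ.+ t) (e-++ i Y Z) (pair-++ is X Y Z))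
      (distrib (e i X) (e i Y) (e i Z) _ _)
      where
      distrib : ∀ a b c d e → a ℤ.* (b ℤ.+ c) ℤ.+ (d ℤ.+ e) ≡ a ℤ.* b ℤ.+ d ℤ.+ (a ℤ.* c ℤ.+ e)
      distrib = ℤ-Ring.solve-∀

    -- The expansion of the squared norm of `X - T` without subtraction: in each coordinate
    -- `x = t + r`, hence `r² + 2xt = x² + t²`.
    pair-removal : ∀ is {X T R} → X ↭ T ++ R →
      pair is R R ℤ.+ ι 2 ℤ.* pair is X T ≡ pair is X X ℤ.+ pair is T T
    pair-removal []       σ = refl
    pair-removal (i ∷ is) {X} {T} {R} σ = begin
      r ℤ.* r ℤ.+ RR ℤ.+ ι 2 ℤ.* (x ℤ.* t ℤ.+ XT)
        ≡⟨ cong (λ x → r ℤ.* r ℤ.+ RR ℤ.+ ι 2 ℤ.* (x ℤ.* t ℤ.+ XT)) x≡ ⟩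
      r ℤ.* r ℤ.+ RR ℤ.+ ι 2 ℤ.* ((t ℤ.+ r) ℤ.* t ℤ.+ XT)
        ≡⟨ shuffle r t RR XT ⟩
      r ℤ.* r ℤ.+ ι 2 ℤ.* ((t ℤ.+ r) ℤ.* t) ℤ.+ (RR ℤ.+ ι 2 ℤ.* XT)
        ≡⟨ cong (λ z → r ℤ.* r ℤ.+ ι 2 ℤ.* ((t ℤ.+ r) ℤ.* t) ℤ.+ z) (pair-removal is σ) ⟩
      r ℤ.* r ℤ.+ ι 2 ℤ.* ((t ℤ.+ r) ℤ.* t) ℤ.+ (XX ℤ.+ TT)
        ≡⟨ square r t XX TT ⟩
      (t ℤ.+ r) ℤ.* (t ℤ.+ r) ℤ.+ XX ℤ.+ (t ℤ.* t ℤ.+ TT)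
        ≡⟨ cong (λ x → x ℤ.* x ℤ.+ XX ℤ.+ (t ℤ.* t ℤ.+ TT)) x≡ ⟨
      x ℤ.* x ℤ.+ XX ℤ.+ (t ℤ.* t ℤ.+ TT) ∎
      where
      open ≡-Reasoning
      x  = e i X
      t  = e i T
      r  = e i R
      XX = pair is X X
      XT = pair is X T
      RR = pair is R R
      TT = pair is T T
      x≡ : x ≡ t ℤ.+ r
      x≡ = trans (e-↭ i σ) (e-++ i T R)
      shuffle : ∀ r t RR XT → r ℤ.* r ℤ.+ RR ℤ.+ ι 2 ℤ.* ((t ℤ.+ r) ℤ.* t ℤ.+ XT)
        ≡ r ℤ.* r ℤ.+ ι 2 ℤ.* ((t ℤ.+ r) ℤ.* t) ℤ.+ (RR ℤ.+ ι 2 ℤ.* XT)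
      shuffle = ℤ-Ring.solve-∀
      square : ∀ r t XX TT → r ℤ.* r ℤ.+ ι 2 ℤ.* ((t ℤ.+ r) ℤ.* t) ℤ.+ (XX ℤ.+ TT)
        ≡ (t ℤ.+ r) ℤ.* (t ℤ.+ r) ℤ.+ XX ℤ.+ (t ℤ.* t ℤ.+ TT)
      square = ℤ-Ring.solve-∀

    -- A shift that makes the weights below non-negative: a single vertex has deviation at most `p₀`
    -- on each test.
    bound : List A → ℕ
    bound X = p₀ * ∑ tests (λ i → ∣ e i X ∣)

    ∣pair∣≤bound : ∀ X v → ∣ pair tests X [ v ] ∣ ≤ bound X
    ∣pair∣≤bound X v = go tests
      where
      open ≤-Reasoning
      go : ∀ is → ∣ pair is X [ v ] ∣ ≤ p₀ * ∑ is (λ i → ∣ e i X ∣)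
      go []       = z≤n
      go (i ∷ is) = begin
        ∣ e i X ℤ.* e i [ v ] ℤ.+ pair is X [ v ] ∣          ≤⟨ ℤₚ.∣i+j∣≤∣i∣+∣j∣ (e i X ℤ.* e i [ v ]) _ ⟩
        ∣ e i X ℤ.* e i [ v ] ∣ + ∣ pair is X [ v ] ∣        ≡⟨ cong (_+ _) (ℤₚ.abs-* (e i X) _) ⟩
        ∣ e i X ∣ * ∣ e i [ v ] ∣ + ∣ pair is X [ v ] ∣
          ≤⟨ +-mono-≤ (*-monoʳ-≤ ∣ e i X ∣ (≤-trans (∣e∣≤ i [ v ]) (≤-reflexive (*-identityˡ p₀)))) (go is) ⟩
        ∣ e i X ∣ * p₀ + p₀ * ∑ is (λ i → ∣ e i X ∣)         ≡⟨ cong (_+ p₀ * ∑ is (λ i → ∣ e i X ∣)) (*-comm ∣ e i X ∣ p₀) ⟩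
        p₀ * ∣ e i X ∣ + p₀ * ∑ is (λ i → ∣ e i X ∣)         ≡⟨ *-distribˡ-+ p₀ _ _ ⟨
        p₀ * (∣ e i X ∣ + ∑ is (λ i → ∣ e i X ∣))            ∎

    -- Removing `T` changes the potential by `φ T - 2 * pair X T`, so a good tile has a large inner
    -- product with `X`, that is, a small sum of `bound - pair`. The absolute value only moves this
    -- non-negative integer into ℕ.
    weight : List A → A → ℕ
    weight X v = ∣ ι bound X ℤ.- pair tests X [ v ] ∣

    +weight : ∀ X v → ι weight X v ≡ ι bound X ℤ.- pair tests X [ v ]
    +weight X v = ℤₚ.0≤i⇒+∣i∣≡i (ℤₚ.i≤j⇒0≤j-i (≤bound (pair tests X [ v ]) (∣pair∣≤bound X v)))
      where
      ≤bound : ∀ i {n} → ∣ i ∣ ≤ n → i ℤ.≤ ι n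
      ≤bound (ι _)      i≤n = ℤ.+≤+ i≤n
      ≤bound ℤ.-[1+ _ ] _   = ℤ.-≤+

    ∑weight : ∀ X Y → ι ∑ Y (weight X) ℤ.+ pair tests X Y ≡ ι (length Y * bound X)
    ∑weight X []      = pair-[] tests
      where
      pair-[] : ∀ is → ι 0 ℤ.+ pair is X [] ≡ ι 0
      pair-[] []       = refl
      pair-[] (i ∷ is) = trans (cong₂ (λ s t → ι 0 ℤ.+ (e i X ℤ.* s ℤ.+ t)) e-[] (trans (sym (ℤₚ.+-identityˡ _)) (pair-[] is)))
                               (zero-* (e i X))
        where
        e-[] : e i [] ≡ ι 0
        e-[] = cong (λ z → ι z ℤ.- ι 0) (*-zeroʳ p₀)
        zero-* : ∀ a → ι 0 ℤ.+ (a ℤ.* ι 0 ℤ.+ ι 0) ≡ ι 0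
        zero-* = ℤ-Ring.solve-∀
    ∑weight X (v ∷ Y) = begin
      ι weight X v ℤ.+ ι ∑ Y (weight X) ℤ.+ pair tests X (v ∷ Y)
        ≡⟨ cong₂ (λ s t → s ℤ.+ ι ∑ Y (weight X) ℤ.+ t) (+weight X v) (pair-++ tests X [ v ] Y) ⟩
      (ι bound X ℤ.- pv) ℤ.+ ι ∑ Y (weight X) ℤ.+ (pv ℤ.+ pair tests X Y)
        ≡⟨ cancel (ι bound X) pv (ι ∑ Y (weight X)) (pair tests X Y) ⟩
      ι bound X ℤ.+ (ι ∑ Y (weight X) ℤ.+ pair tests X Y)
        ≡⟨ cong (ℤ._+_ (ι bound X)) (∑weight X Y) ⟩
      ι (bound X + length Y * bound X) ∎
      where
      open ≡-Reasoning
      pv = pair tests X [ v ]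
      cancel : ∀ b p w q → (b ℤ.- p) ℤ.+ w ℤ.+ (p ℤ.+ q) ≡ b ℤ.+ (w ℤ.+ q)
      cancel = ℤ-Ring.solve-∀

    -- Here `φ R = φ X + φ T - 2 * pair X T`, where `pair X T` is `length T * β` minus the weight of
    -- `T`. The total weight of `X` is `length X * β - φ X`, so lightness keeps the cross term below
    -- `2 * E * β / s`, with `E` the excess of `length X` over `s * length T`. A favourable
    -- `2 * φ X / s` is dropped.
    φ-step : ∀ {X T R s E Z} → X ↭ T ++ R → 0 < s →
      s * ∑ T (weight X) ≤ ∑ X (weight X) →
      length X ≤ s * length T + E → 2 * (E * bound X) ≤ s * Z →
      φ R ≤ φ X + Z + φ T
    φ-step {X} {T} {R} {s} {E} {Z} X↭ 0<s light X≤ E≤ =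
      *-cancelˡ-≤ s {{>-nonZero 0<s}} (≤-by P≤Q (2 * φ X) (combine s (φ R) t β wT (φ X) wX x E (φ T) Z))
      where
      β  = bound X
      wT = ∑ T (weight X)
      wX = ∑ X (weight X)
      t  = length T
      x  = length X
      φX+wX : φ X + wX ≡ x * β
      φX+wX = ℤₚ.+-injective (trans (cong (ℤ._+ ι wX) (φ≡pair X))
        (trans (ℤₚ.+-comm (pair tests X X) (ι wX)) (∑weight X X)))
      φR+2tβ : φ R + 2 * (t * β) ≡ φ X + φ T + 2 * wT
      φR+2tβ = ℤₚ.+-injective (begin
        ι φ R ℤ.+ (ι (t * β) ℤ.+ (ι (t * β) ℤ.+ ι 0))
          ≡⟨ cong₂ (λ u v → u ℤ.+ (v ℤ.+ (v ℤ.+ ι 0))) (φ≡pair R) (sym (∑weight X T)) ⟩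
        RR ℤ.+ ((ι wT ℤ.+ XT) ℤ.+ ((ι wT ℤ.+ XT) ℤ.+ ι 0))
          ≡⟨ shuffle RR (ι wT) XT ⟩
        (RR ℤ.+ ι 2 ℤ.* XT) ℤ.+ (ι wT ℤ.+ (ι wT ℤ.+ ι 0))
          ≡⟨ cong (ℤ._+ ι (2 * wT)) (pair-removal tests X↭) ⟩
        pair tests X X ℤ.+ pair tests T T ℤ.+ ι (2 * wT)
          ≡⟨ cong₂ (λ u v → u ℤ.+ v ℤ.+ ι (2 * wT)) (φ≡pair X) (φ≡pair T) ⟨
        ι (φ X + φ T + 2 * wT) ∎)
        where
        open ≡-Reasoning
        RR = pair tests R R
        XT = pair tests X T
        shuffle : ∀ r w p → r ℤ.+ ((w ℤ.+ p) ℤ.+ ((w ℤ.+ p) ℤ.+ ι 0))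
          ≡ (r ℤ.+ ι 2 ℤ.* p) ℤ.+ (w ℤ.+ (w ℤ.+ ι 0))
        shuffle = ℤ-Ring.solve-∀
      P≤Q : s * (φ R + 2 * (t * β)) + 2 * (s * wT) + 2 * (φ X + wX) + 2 * (x * β) + 2 * (E * β)
          ≤ s * (φ X + φ T + 2 * wT) + 2 * wX + 2 * (x * β) + 2 * ((s * t + E) * β) + s * Z
      P≤Q = +-mono-≤ (+-mono-≤ (+-mono-≤ (+-mono-≤
        (≤-reflexive (cong (s *_) φR+2tβ)) (*-monoʳ-≤ 2 light))
        (≤-reflexive (cong (2 *_) φX+wX))) (*-monoʳ-≤ 2 (*-monoˡ-≤ β X≤))) E≤
      combine : ∀ s fR t β wT fX wX x E fT Z →
        s * fR + (s * (fX + fT + 2 * wT) + 2 * wX + 2 * (x * β) + 2 * ((s * t + E) * β) + s * Z) + 2 * fX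
        ≡ s * (fX + Z + fT) + (s * (fR + 2 * (t * β)) + 2 * (s * wT) + 2 * (fX + wX) + 2 * (x * β) + 2 * (E * β))
      combine = solve-∀

    -- 2ab ≤ a² + b² in the form 2mY|e| ≤ m²e² + Y², summed over the tests.
    ∑∣e∣≤ : ∀ X m Y → 2 * m * Y * ∑ tests (λ i → ∣ e i X ∣) ≤ m * m * φ X + length tests * (Y * Y)
    ∑∣e∣≤ X m Y = begin
      2 * m * Y * ∑ tests (λ i → ∣ e i X ∣)
        ≡⟨ ∑-*ˡ tests (2 * m * Y) _ ⟨
      ∑ tests (λ i → 2 * m * Y * ∣ e i X ∣)
        ≤⟨ ∑-mono tests (λ {i} _ → am-gm ∣ e i X ∣) ⟩
      ∑ tests (λ i → m * m * (∣ e i X ∣ * ∣ e i X ∣) + Y * Y)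
        ≡⟨ ∑-+ tests _ _ ⟩
      ∑ tests (λ i → m * m * (∣ e i X ∣ * ∣ e i X ∣)) + ∑ tests (λ _ → Y * Y)
        ≡⟨ cong₂ _+_ (∑-*ˡ tests (m * m) _) (∑-const tests (Y * Y)) ⟩
      m * m * φ X + length tests * (Y * Y) ∎
      where
      open ≤-Reasoning
      2ab≤a²+b² : ∀ a b → 2 * (a * b) ≤ a * a + b * b
      2ab≤a²+b² a b with ≤-total a b
      ... | inj₁ a≤b = subst (λ b → 2 * (a * b) ≤ a * a + b * b) (m+[n∸m]≡n a≤b)
                         (≤-by z≤n ((b ∸ a) * (b ∸ a)) (gap a (b ∸ a)))
        where
        gap : ∀ a d → 2 * (a * (a + d)) + 0 + d * d ≡ a * a + (a + d) * (a + d) + 0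
        gap = solve-∀
      ... | inj₂ b≤a = subst (λ a → 2 * (a * b) ≤ a * a + b * b) (m+[n∸m]≡n b≤a)
                         (≤-by z≤n ((a ∸ b) * (a ∸ b)) (gap b (a ∸ b)))
        where
        gap : ∀ b d → 2 * ((b + d) * b) + 0 + d * d ≡ (b + d) * (b + d) + b * b + 0
        gap = solve-∀
      am-gm : ∀ x → 2 * m * Y * x ≤ m * m * (x * x) + Y * Y
      am-gm x = subst₂ _≤_ (lhs m x Y) (rhs m x Y) (2ab≤a²+b² (m * x) Y)
        where
        lhs : ∀ m x Y → 2 * (m * x * Y) ≡ 2 * m * Y * x
        lhs = solve-∀
        rhs : ∀ m x Y → m * x * (m * x) + Y * Y ≡ m * m * (x * x) + Y * Y
        rhs = solve-∀

  ∣ιa-ιb∣≤c⇒a≤c+b : ∀ a b {c} → ∣ ι a ℤ.- ι b ∣ ≤ c → a ≤ c + b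
  ∣ιa-ιb∣≤c⇒a≤c+b a b {c} ≤c with ≤-total a b
  ... | inj₁ a≤b = ≤-trans a≤b (m≤n+m b c)
  ... | inj₂ b≤a = ≤-trans (≤-reflexive (sym (m∸n+n≡m b≤a))) (+-monoˡ-≤ b (≤-trans (≤-reflexive (sym eq)) ≤c))
    where
    eq : ∣ ι a ℤ.- ι b ∣ ≡ a ∸ b
    eq = cong ∣_∣ (trans (ℤₚ.m-n≡m⊖n a b) (ℤₚ.⊖-≥ b≤a))

  -- Almost tiling by successive removal of light tiles.

  module NibbleConstants (r E₀ y : ℕ) where

    -- `κ` times `n³` bounds the growth of the potential per tile, `E₁` counts what the exceptional
    -- vertices (at most `E₀`) and the slack of `light-cone` may cost, and `m` is the multiplier in
    -- the estimate of the total deviation.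
    κ E₁ m : ℕ
    κ  = 2 * (r * r) + 1
    E₁ = E₀ + slack r
    m  = r * E₁ * y

  module Nibble {n : ℕ} (G : Digraph n) (r s g t E₀ y : ℕ) (X₀ : List (Fin n)) where

    open Cones G

    V : List (Fin n)
    V = allFin n

    -- Summed over `X`, these tests are exactly `D⁺ X x` and `D⁻ X x`, so the potential watches all
    -- degrees into the remaining set.
    χ : Bool × Fin n → Fin n → ℕ
    χ (true  , x) v = ⟦ ¬? (x ⟶? v) ⟧
    χ (false , x) v = ⟦ ¬? (v ⟶? x) ⟧

    χ≤1 : ∀ i v → χ i v ≤ 1
    χ≤1 (true  , x) v = ⟦⟧≤1 (¬? (x ⟶? v))
    χ≤1 (false , x) v = ⟦⟧≤1 (¬? (v ⟶? x))

    out inn : Fin n → Bool × Fin n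
    out x = true , x
    inn x = false , x

    tests : List (Bool × Fin n)
    tests = map out V ++ map inn V

    open Discrepancy tests χ χ≤1 X₀

    open NibbleConstants r E₀ y

    n³ Δ : ℕ
    n³ = n * n * n
    Δ  = t * g

    length-tests : length tests ≡ n + n
    length-tests = begin
      length tests                                         ≡⟨ Listₚ.length-++ (map out V) {map inn V} ⟩
      length (map out V) + length (map inn V)
        ≡⟨ cong₂ _+_ (Listₚ.length-map out V) (Listₚ.length-map inn V) ⟩
      length V + length V
        ≡⟨ cong (λ l → l + l) (Listₚ.length-tabulate {n = n} id) ⟩
      n + n                                                ∎
      where open ≡-Reasoning

    sq⁺ sq⁻ : List (Fin n) → Fin n → ℕ
    sq⁺ X x = ∣ e (true  , x) X ∣ * ∣ e (true  , x) X ∣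
    sq⁻ X x = ∣ e (false , x) X ∣ * ∣ e (false , x) X ∣

    φ≡ : ∀ X → φ X ≡ ∑ V (λ x → sq⁺ X x + sq⁻ X x)
    φ≡ X = begin
      φ X
        ≡⟨ ∑-++ (map out V) (map inn V) e² ⟩
      ∑ (map out V) e² + ∑ (map inn V) e²
        ≡⟨ cong₂ _+_ (∑-map out V e²) (∑-map inn V e²) ⟩
      ∑ V (sq⁺ X) + ∑ V (sq⁻ X)
        ≡⟨ ∑-+ V (sq⁺ X) (sq⁻ X) ⟨
      ∑ V (λ x → sq⁺ X x + sq⁻ X x) ∎
      where
      open ≡-Reasoning
      e² : Bool × Fin n → ℕ
      e² i = ∣ e i X ∣ * ∣ e i X ∣

    Exceptional : List (Fin n) → Fin n → Set
    Exceptional X x = Δ < ∣ e (true , x) X ∣ ⊎ Δ < ∣ e (false , x) X ∣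

    Exceptional? : ∀ X x → Dec (Exceptional X x)
    Exceptional? X x = (Δ <? ∣ e (true , x) X ∣) ⊎-dec (Δ <? ∣ e (false , x) X ∣)

    -- Chebyshev's inequality: each exceptional vertex contributes at least `Δ * Δ` to the
    -- potential.
    few-exceptional : ∀ {X} → X ⊑ V → length (filter (Exceptional? X) X) * (Δ * Δ) ≤ φ X
    few-exceptional {X} X⊑V = begin
      length (filter (Exceptional? X) X) * (Δ * Δ)   ≡⟨ ∑-const (filter (Exceptional? X) X) (Δ * Δ) ⟨
      ∑ (filter (Exceptional? X) X) (λ _ → Δ * Δ)    ≤⟨ ∑-mono (filter (Exceptional? X) X) large ⟩
      ∑ (filter (Exceptional? X) X) (λ x → sq⁺ X x + sq⁻ X x)
        ≤⟨ ⊑-∑ _ (⊑-trans (⊑-filter (Exceptional? X) X) X⊑V) ⟩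
      ∑ V (λ x → sq⁺ X x + sq⁻ X x)                   ≡⟨ φ≡ X ⟨
      φ X                                             ∎
      where
      open ≤-Reasoning
      large : ∀ {x} → x ∈ filter (Exceptional? X) X → Δ * Δ ≤ sq⁺ X x + sq⁻ X x
      large x∈ with proj₂ (∈-filter⁻ (Exceptional? X) {xs = X} x∈)
      ... | inj₁ Δ< = ≤-trans (*-mono-≤ (<⇒≤ Δ<) (<⇒≤ Δ<)) (m≤m+n _ _)
      ... | inj₂ Δ< = ≤-trans (*-mono-≤ (<⇒≤ Δ<) (<⇒≤ Δ<)) (m≤n+m _ _)

    -- `E₀-large` caps the number of exceptional vertices, `nE₁≤Δ` makes the loss of `E₁` comparable
    -- with the tolerated deviation, and `y-large` keeps the linear error of one step below `n³`.
    record Hypotheses : Set where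
      field
        ore   : ∀ {x y} → x ≢ y → ¬ x ⟶ y → D⁺ V x + D⁻ V y + 2 * (r * g) ≤ 2 * s
        n≡rs  : n ≡ r * s
        n≡p₀+g : n ≡ p₀ + g
        2≤r   : 2 ≤ r
        0<y   : 0 < y
        0<p₀  : 0 < p₀
        0<Δ   : 0 < Δ
        X₀⊑V  : X₀ ⊑ V
        E₀-large : κ * n³ * n ≤ E₀ * (Δ * Δ)
        nE₁≤Δ    : n * E₁ ≤ Δ
        y-large  : m * m * κ + 2 * n + y * E₁ ≤ y * t

    module _ (H : Hypotheses) where

      open Hypotheses H

      V-unique : Unique V
      V-unique = Uniqueₚ.allFin⁺ n

      p₀≤n : p₀ ≤ n
      p₀≤n = ≤-trans (m≤m+n p₀ g) (≤-reflexive (sym n≡p₀+g))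

      0<n : 0 < n
      0<n = ≤-trans 0<p₀ p₀≤n

      module Step {X q} (X⊑X₀ : X ⊑ X₀) (∣X∣ : length X ≡ r * q) (t≤q : t ≤ q)
                  (φX≤ : φ X ≤ κ * n³ * n) where

        E₁<t : E₁ < t
        E₁<t = *-cancelˡ-< y E₁ t (begin-strict
          y * E₁                         <⟨ m<n+m (y * E₁) {m * m * κ + 2 * n} (≤-trans 0<n (≤-trans (m≤m+n n (n + 0)) (m≤n+m (2 * n) (m * m * κ)))) ⟩
          m * m * κ + 2 * n + y * E₁     ≤⟨ y-large ⟩
          y * t                          ∎)
          where open ≤-Reasoning

        -- Now `q`, which is `length X / r`, plays the role of `s`. Lowering it by `E₁` frees
        -- `r * E₁` vertices, enough for the exceptional ones and for `slack r`.
        σ = q ∸ E₁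

        σ+E₁≡q : σ + E₁ ≡ q
        σ+E₁≡q = m∸n+n≡m (≤-trans (<⇒≤ E₁<t) t≤q)

        0<σ : 0 < σ
        0<σ = m<n⇒0<n∸m (≤-trans E₁<t t≤q)

        X⊑V : X ⊑ V
        X⊑V = ⊑-trans X⊑X₀ X₀⊑V

        X′ : List (Fin n)
        X′ = filter (¬? ∘ Exceptional? X) X

        X′⊑X : X′ ⊑ X
        X′⊑X = ⊑-filter (¬? ∘ Exceptional? X) X

        exceptional≤E₀ : length (filter (Exceptional? X) X) ≤ E₀
        exceptional≤E₀ = *-cancelʳ-≤ _ _ (Δ * Δ) {{>-nonZero (*-mono-≤ 0<Δ 0<Δ)}}
          (≤-trans (few-exceptional X⊑V) (≤-trans φX≤ E₀-large))

        enough : r * σ + slack r ≤ length X′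
        enough = ≤-by P≤Q 0 (combine r σ E₀ (slack r) (length (filter (Exceptional? X) X)) (length X′) (r * q))
          where
          open ≤-Reasoning
          P≤Q : E₁ + (r * σ + r * E₁) + length (filter (Exceptional? X) X) + r * q
              ≤ r * E₁ + r * q + E₀ + (length (filter (Exceptional? X) X) + length X′)
          P≤Q = +-mono-≤ (+-mono-≤ (+-mono-≤
            (≤-trans (≤-reflexive (sym (*-identityˡ E₁))) (*-monoˡ-≤ E₁ (≤-trans (s≤s z≤n) 2≤r)))
            (≤-reflexive (trans (sym (*-distribˡ-+ r σ E₁)) (cong (r *_) σ+E₁≡q))))
            exceptional≤E₀)
            (≤-reflexive (trans (sym ∣X∣) (length-partition (Exceptional? X) X)))
          combine : ∀ r σ E₀ S x x′ rq →
            r * σ + S + (r * (E₀ + S) + rq + E₀ + (x + x′)) + 0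
            ≡ x′ + (E₀ + S + (r * σ + r * (E₀ + S)) + x + rq)
          combine = solve-∀

        -- Degrees of typical vertices into `X` are proportional to those into `X₀` up to `Δ`. After
        -- scaling, the Ore gap `2r²qg`, at least `8qg`, pays `2Δ` for the two deviations, `2Δ` for
        -- passing from `q` to `σ`, and `2qg` for the `g` vertices outside `X₀`; and `Δ ≤ q * g`
        -- because `t ≤ q`.
        ore′ : Ore X′ (2 * σ)
        ore′ {x} {z} x∈ z∈ x≢z x↛z = *-cancelˡ-≤ p₀ {{>-nonZero 0<p₀}} (begin
          p₀ * (D⁺ X′ x + D⁻ X′ z)
            ≤⟨ *-monoʳ-≤ p₀ (+-mono-≤ (⊑-∑ _ X′⊑X) (⊑-∑ _ X′⊑X)) ⟩
          p₀ * (D⁺ X x + D⁻ X z)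
            ≤⟨ ≤-by P≤Q (2 * (q * g)) (combine p₀ (D⁺ X x) (D⁻ X z) Δ r q (D⁺ X₀ x) (D⁻ X₀ z) s g σ E₁) ⟩
          p₀ * (2 * σ) ∎)
          where
          open ≤-Reasoning
          typical : ∀ {v} → v ∈ X′ → ¬ Exceptional X v
          typical v∈ = proj₂ (∈-filter⁻ (¬? ∘ Exceptional? X) {xs = X} v∈)
          deg⁺ : p₀ * D⁺ X x ≤ Δ + r * q * D⁺ X₀ x
          deg⁺ = subst (λ l → p₀ * D⁺ X x ≤ Δ + l * D⁺ X₀ x) ∣X∣
            (∣ιa-ιb∣≤c⇒a≤c+b (p₀ * D⁺ X x) (length X * D⁺ X₀ x) (≮⇒≥ (typical x∈ ∘ inj₁)))
          deg⁻ : p₀ * D⁻ X z ≤ Δ + r * q * D⁻ X₀ z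
          deg⁻ = subst (λ l → p₀ * D⁻ X z ≤ Δ + l * D⁻ X₀ z) ∣X∣
            (∣ιa-ιb∣≤c⇒a≤c+b (p₀ * D⁻ X z) (length X * D⁻ X₀ z) (≮⇒≥ (typical z∈ ∘ inj₂)))
          ore₀ : D⁺ X₀ x + D⁻ X₀ z + 2 * (r * g) ≤ 2 * s
          ore₀ = ≤-trans (+-monoˡ-≤ (2 * (r * g)) (+-mono-≤ (⊑-∑ _ X₀⊑V) (⊑-∑ _ X₀⊑V))) (ore x≢z x↛z)
          P≤Q : p₀ * D⁺ X x + p₀ * D⁻ X z + r * q * (D⁺ X₀ x + D⁻ X₀ z + 2 * (r * g)) + 2 * q * (r * s)
                + 2 * p₀ * q + 2 * (p₀ * E₁) + 4 * Δ + 2 * (2 * 2 * (q * g))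
              ≤ (Δ + r * q * D⁺ X₀ x) + (Δ + r * q * D⁻ X₀ z) + r * q * (2 * s) + 2 * q * (p₀ + g)
                + 2 * p₀ * (σ + E₁) + 2 * Δ + 4 * (q * g) + 2 * (r * r * (q * g))
          P≤Q = +-mono-≤ (+-mono-≤ (+-mono-≤ (+-mono-≤ (+-mono-≤ (+-mono-≤ (+-mono-≤
            deg⁺ deg⁻) (*-monoʳ-≤ (r * q) ore₀))
            (*-monoʳ-≤ (2 * q) (≤-reflexive (trans (sym n≡rs) n≡p₀+g))))
            (*-monoʳ-≤ (2 * p₀) (≤-reflexive (sym σ+E₁≡q))))
            (*-monoʳ-≤ 2 (≤-trans (*-monoˡ-≤ E₁ p₀≤n) nE₁≤Δ)))
            (*-monoʳ-≤ 4 (*-monoˡ-≤ g t≤q)))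
            (*-monoʳ-≤ 2 (*-monoˡ-≤ (q * g) (*-mono-≤ 2≤r 2≤r)))
          combine : ∀ p d d′ Δ r q a a′ s g σ E →
            p * (d + d′) + ((Δ + r * q * a) + (Δ + r * q * a′) + r * q * (2 * s) + 2 * q * (p + g)
                + 2 * p * (σ + E) + 2 * Δ + 4 * (q * g) + 2 * (r * r * (q * g))) + 2 * (q * g)
            ≡ p * (2 * σ) + (p * d + p * d′ + r * q * (a + a′ + 2 * (r * g)) + 2 * q * (r * s)
                + 2 * p * q + 2 * (p * E) + 4 * Δ + 2 * (2 * 2 * (q * g)))
          combine = solve-∀

        ∑e = ∑ tests (λ i → ∣ e i X ∣)

        -- There are `2n` tests and the potential is at most `κ` times `n⁴`, so by Cauchy-Schwarz
        -- the sum has order `n^(5/2)`. The choice `Y = n²` in the inequality between means replaces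
        -- the square root.
        ∑e-small : 2 * (r * E₁) * ∑e ≤ σ * (n * n)
        ∑e-small = *-cancelˡ-≤ (y * (n * n)) {{>-nonZero (*-mono-≤ 0<y (*-mono-≤ 0<n 0<n))}} (begin
          y * (n * n) * (2 * (r * E₁) * ∑e)      ≡⟨ lhs r E₁ y n ∑e ⟩
          2 * m * (n * n) * ∑e                   ≤⟨ ∑∣e∣≤ X m (n * n) ⟩
          m * m * φ X + length tests * (n * n * (n * n))
            ≤⟨ +-mono-≤ (*-monoʳ-≤ (m * m) φX≤) (≤-reflexive (cong (_* (n * n * (n * n))) length-tests)) ⟩
          m * m * (κ * n³ * n) + (n + n) * (n * n * (n * n))
            ≡⟨ collect (m * m) κ n ⟩
          (m * m * κ + 2 * n) * (n * n * (n * n))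
            ≤⟨ *-monoˡ-≤ (n * n * (n * n)) y-large′ ⟩
          y * σ * (n * n * (n * n))              ≡⟨ rhs y σ (n * n) ⟩
          y * (n * n) * (σ * (n * n))            ∎)
          where
          open ≤-Reasoning
          lhs : ∀ r E y n S → y * (n * n) * (2 * (r * E) * S) ≡ 2 * (r * E * y) * (n * n) * S
          lhs = solve-∀
          rhs : ∀ y σ n² → y * σ * (n² * n²) ≡ y * n² * (σ * n²)
          rhs = solve-∀
          collect : ∀ M κ n → M * (κ * (n * n * n) * n) + (n + n) * (n * n * (n * n)) ≡ (M * κ + 2 * n) * (n * n * (n * n))
          collect = solve-∀
          y-large′ : m * m * κ + 2 * n ≤ y * σ
          y-large′ = ≤-by P≤Q 0 (combine y σ E₁ (m * m * κ + 2 * n) t q)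
            where
            P≤Q : (m * m * κ + 2 * n + y * E₁) + y * t + y * q ≤ y * t + y * q + y * (σ + E₁)
            P≤Q = +-mono-≤ (+-mono-≤ y-large (*-monoʳ-≤ y t≤q)) (*-monoʳ-≤ y (≤-reflexive (sym σ+E₁≡q)))
            combine : ∀ y σ E L t q → L + (y * t + y * q + y * (σ + E)) + 0 ≡ y * σ + ((L + y * E) + y * t + y * q)
            combine = solve-∀

        -- The potential grows by at most `n³` through the linear term and by `2n * (rn)²` through
        -- the tile itself, together `κ * n³`.
        step : ∃[ T ] ∃[ R ] X ↭ T ++ R × Tileable r T × length T ≡ r × φ R ≤ φ X + κ * n³
        step = T , R , X↭ , Cone⇒Tileable T len cone , len , φR≤
          where
          open ≤-Reasoning
          lc    = light-cone r σ X′ (weight X) 0<σ (⊑-Unique (⊑-trans X′⊑X X⊑V) V-unique) enough ore′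
          T     = proj₁ lc
          T⊑X   = ⊑-trans (proj₁ (proj₂ lc)) X′⊑X
          R     = proj₁ T⊑X
          X↭    = proj₂ T⊑X
          cone  = proj₁ (proj₂ (proj₂ lc))
          len   = proj₁ (proj₂ (proj₂ (proj₂ lc)))
          light : σ * ∑ T (weight X) ≤ ∑ X (weight X)
          light = ≤-trans (proj₂ (proj₂ (proj₂ (proj₂ lc)))) (⊑-∑ _ X′⊑X)
          size : length X ≤ σ * length T + r * E₁
          size = ≤-reflexive (begin-equality
            length X                   ≡⟨ ∣X∣ ⟩
            r * q                      ≡⟨ cong (r *_) σ+E₁≡q ⟨
            r * (σ + E₁)               ≡⟨ *-distribˡ-+ r σ E₁ ⟩
            r * σ + r * E₁             ≡⟨ cong (_+ r * E₁) (*-comm r σ) ⟩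
            σ * r + r * E₁             ≡⟨ cong (λ l → σ * l + r * E₁) len ⟨
            σ * length T + r * E₁      ∎)
          small : 2 * (r * E₁ * bound X) ≤ σ * n³
          small = begin
            2 * (r * E₁ * (p₀ * ∑e))     ≡⟨ regroup (r * E₁) p₀ ∑e ⟩
            p₀ * (2 * (r * E₁) * ∑e)     ≤⟨ *-mono-≤ p₀≤n ∑e-small ⟩
            n * (σ * (n * n))            ≡⟨ regroup′ n σ ⟩
            σ * n³                       ∎
            where
            regroup : ∀ a p S → 2 * (a * (p * S)) ≡ p * (2 * a * S)
            regroup = solve-∀
            regroup′ : ∀ n σ → n * (σ * (n * n)) ≡ σ * (n * n * n)
            regroup′ = solve-∀
          φR≤ : φ R ≤ φ X + κ * n³
          φR≤ = begin
            φ R                          ≤⟨ φ-step {X} {T} {R} X↭ 0<σ light size small ⟩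
            φ X + n³ + φ T               ≤⟨ +-monoʳ-≤ (φ X + n³) (φ-bound T) ⟩
            φ X + n³ + length tests * ((length T * p₀) * (length T * p₀))
              ≡⟨ cong₂ (λ a b → φ X + n³ + a * ((b * p₀) * (b * p₀))) length-tests len ⟩
            φ X + n³ + (n + n) * ((r * p₀) * (r * p₀))
              ≤⟨ +-monoʳ-≤ (φ X + n³) (*-monoʳ-≤ (n + n) (*-mono-≤ (*-monoʳ-≤ r p₀≤n) (*-monoʳ-≤ r p₀≤n))) ⟩
            φ X + n³ + (n + n) * ((r * n) * (r * n))
              ≡⟨ collect (φ X) n r ⟩
            φ X + κ * n³                 ∎
            where
            collect : ∀ a n r → a + n * n * n + (n + n) * ((r * n) * (r * n)) ≡ a + (2 * (r * r) + 1) * (n * n * n)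
            collect = solve-∀

      -- The invariant allots `κ * n³` to every remaining vertex. A step frees the allotment of `r`
      -- vertices and spends one, and the invariant keeps the potential below `κ * n³ * n`, as each
      -- step requires.
      nibble : ∀ i X → X ⊑ X₀ → length X ≡ r * (t + i) → φ X + length X * (κ * n³) ≤ n * (κ * n³) →
        ∃[ Y ] ∃[ U ] X ↭ Y ++ U × Tileable r Y × length U ≡ r * t
      nibble zero    X _    ∣X∣ _   =
        [] , X , ↭-refl , Tileable-[] , trans ∣X∣ (cong (r *_) (+-identityʳ t))
      nibble (suc i) X X⊑X₀ ∣X∣ inv =
        T ++ Y , U , X↭T++Y++U , Tileable-++ tileT tileY , ∣U∣
        where
        open Step X⊑X₀ ∣X∣ (m≤m+n t (suc i))
          (≤-trans (m≤m+n _ _) (≤-trans inv (≤-reflexive (*-comm n (κ * n³)))))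
        T = proj₁ step
        R = proj₁ (proj₂ step)
        X↭ = proj₁ (proj₂ (proj₂ step))
        tileT = proj₁ (proj₂ (proj₂ (proj₂ step)))
        ∣T∣ = proj₁ (proj₂ (proj₂ (proj₂ (proj₂ step))))
        φR≤ = proj₂ (proj₂ (proj₂ (proj₂ (proj₂ step))))
        ∣X∣≡r+∣R∣ : length X ≡ r + length R
        ∣X∣≡r+∣R∣ = trans (↭ₚ.↭-length X↭) (trans (Listₚ.length-++ T) (cong (_+ length R) ∣T∣))
        ∣R∣ : length R ≡ r * (t + i)
        ∣R∣ = +-cancelˡ-≡ r _ _ (trans (sym ∣X∣≡r+∣R∣) (trans ∣X∣ (unfold r t i)))
          where
          unfold : ∀ r t i → r * (t + suc i) ≡ r + r * (t + i)
          unfold = solve-∀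
        inv′ : φ R + length R * (κ * n³) ≤ n * (κ * n³)
        inv′ = begin
          φ R + length R * (κ * n³)               ≤⟨ +-monoˡ-≤ _ φR≤ ⟩
          φ X + κ * n³ + length R * (κ * n³)      ≡⟨ +-assoc (φ X) _ _ ⟩
          φ X + suc (length R) * (κ * n³)
            ≤⟨ +-monoʳ-≤ (φ X) (*-monoˡ-≤ (κ * n³) (+-monoˡ-≤ (length R) (≤-trans (s≤s z≤n) 2≤r))) ⟩
          φ X + (r + length R) * (κ * n³)         ≡⟨ cong (λ l → φ X + l * (κ * n³)) ∣X∣≡r+∣R∣ ⟨
          φ X + length X * (κ * n³)               ≤⟨ inv ⟩
          n * (κ * n³)                            ∎
          where open ≤-Reasoning
        ih = nibble i R (⊑-trans (T , ↭-trans X↭ (↭ₚ.++-comm T R)) X⊑X₀) ∣R∣ inv′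
        Y = proj₁ ih
        U = proj₁ (proj₂ ih)
        R↭ = proj₁ (proj₂ (proj₂ ih))
        tileY = proj₁ (proj₂ (proj₂ (proj₂ ih)))
        ∣U∣ = proj₂ (proj₂ (proj₂ (proj₂ ih)))
        X↭T++Y++U : X ↭ (T ++ Y) ++ U
        X↭T++Y++U = ↭-trans X↭ (↭-trans (↭ₚ.++⁺ˡ T R↭) (↭-reflexive (sym (Listₚ.++-assoc T Y U))))

      almost-tiling : ∀ i → p₀ ≡ r * (t + i) →
        ∃[ Y ] ∃[ U ] X₀ ↭ Y ++ U × Tileable r Y × length U ≡ r * t
      almost-tiling i p₀≡ = nibble i X₀ ⊑-refl p₀≡
        (subst (λ z → z + p₀ * (κ * n³) ≤ n * (κ * n³)) (sym φ-initial) (*-monoˡ-≤ (κ * n³) p₀≤n))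

  -- Density of properties of tuples.

  ∑-cartesianProductWith : ∀ (f : A → B → C) xs ys c →
    ∑ (cartesianProductWith f xs ys) c ≡ ∑ xs (λ x → ∑ ys (λ y → c (f x y)))
  ∑-cartesianProductWith f []       ys c = refl
  ∑-cartesianProductWith f (x ∷ xs) ys c =
    trans (∑-++ (map (f x) ys) _ c) (cong₂ _+_ (∑-map (f x) ys c) (∑-cartesianProductWith f xs ys c))

  length-cartesianProductWith : ∀ (f : A → B → C) xs ys →
    length (cartesianProductWith f xs ys) ≡ length xs * length ys
  length-cartesianProductWith f []       ys = refl
  length-cartesianProductWith f (x ∷ xs) ys = trans (Listₚ.length-++ (map (f x) ys))
    (cong₂ _+_ (Listₚ.length-map (f x) ys) (length-cartesianProductWith f xs ys))

  -- The elements satisfying P make up at least a fraction 1/b of xs. Quantifying over all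
  -- weightings c spares a decision procedure for P and makes densities compose.
  record Dense {A : Set ℓ} (b : ℕ) (xs : List A) (P : A → Set) : Set ℓ where
    constructor dense
    field weigh : ∀ c β → (∀ x → P x → β ≤ c x) → length xs * β ≤ b * ∑ xs c
  open Dense

  Dense-mono : ∀ {b} {xs : List A} {P Q : A → Set} → (∀ {x} → P x → Q x) → Dense b xs P → Dense b xs Q
  Dense-mono P⇒Q d = dense λ c β h → weigh d c β (λ x → h x ∘ P⇒Q)

  Dense-⊑ : ∀ {b} {xs ys : List A} {P : A → Set} → ys ⊑ xs → (∀ {x} → x ∈ ys → P x) →
    length xs ≤ b * length ys → Dense b xs P
  Dense-⊑ {b = b} {xs} {ys} ys⊑xs all ≤b = dense λ c β h → begin
    length xs * β           ≤⟨ *-monoˡ-≤ β ≤b ⟩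
    b * length ys * β       ≡⟨ *-assoc b _ β ⟩
    b * (length ys * β)     ≡⟨ cong (b *_) (∑-const ys β) ⟨
    b * ∑ ys (λ _ → β)      ≤⟨ *-monoʳ-≤ b (∑-mono ys (λ {x} x∈ → h x (all x∈))) ⟩
    b * ∑ ys c              ≤⟨ *-monoʳ-≤ b (⊑-∑ c ys⊑xs) ⟩
    b * ∑ xs c              ∎
    where open ≤-Reasoning

  -- Coordinates are chosen one after the other, the second depending on the first: `xs` is weighed
  -- by `b′` times the sum over the fibre.
  Dense-× : ∀ {b b′} {xs : List A} {ys : List B} {f : A → B → C} {Q : A → Set} {P : C → Set} →
    Dense b xs Q → (∀ x → Q x → Dense b′ ys (λ y → P (f x y))) →
    Dense (b * b′) (cartesianProductWith f xs ys) P
  Dense-× {b = b} {b′} {xs} {ys} {f} denseQ denseP = dense λ c β h → begin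
    length (cartesianProductWith f xs ys) * β
      ≡⟨ cong (_* β) (length-cartesianProductWith f xs ys) ⟩
    length xs * length ys * β
      ≡⟨ *-assoc (length xs) _ β ⟩
    length xs * (length ys * β)
      ≤⟨ weigh denseQ (λ x → b′ * ∑ ys (λ y → c (f x y))) _ (λ x Qx → weigh (denseP x Qx) (c ∘ f x) β (h ∘ f x)) ⟩
    b * ∑ xs (λ x → b′ * ∑ ys (λ y → c (f x y)))
      ≡⟨ cong (b *_) (∑-*ˡ xs b′ _) ⟩
    b * (b′ * ∑ xs (λ x → ∑ ys (λ y → c (f x y))))
      ≡⟨ *-assoc b b′ _ ⟨
    b * b′ * ∑ xs (λ x → ∑ ys (λ y → c (f x y)))
      ≡⟨ cong (b * b′ *_) (∑-cartesianProductWith f xs ys c) ⟨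
    b * b′ * ∑ (cartesianProductWith f xs ys) c ∎
    where open ≤-Reasoning

  vecs : ∀ k → List A → List (Vec A k)
  vecs zero    xs = [ [] ]
  vecs (suc k) xs = cartesianProductWith _∷_ xs (vecs k xs)

  Dense-[] : {P : Vec A 0 → Set} {xs : List A} → P [] → Dense 1 (vecs 0 xs) P
  Dense-[] P[] = dense λ c β h → +-mono-≤ (≤-trans (h [] P[]) (m≤m+n _ 0)) z≤n

  module _ {n : ℕ} where

    open DecMembership (Finₚ._≟_ {n}) using (_∈?_) public

    ∑∈≤length : ∀ Z → ∑ (allFin n) (λ v → ⟦ v ∈? Z ⟧) ≤ length Z
    ∑∈≤length [] = ≤-reflexive (trans (∑-cong (allFin n) λ _ → refl) (trans (∑-const (allFin n) 0) (*-zeroʳ (length (allFin n)))))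
    ∑∈≤length (z ∷ Z) = begin
      ∑ V (λ v → ⟦ v ∈? (z ∷ Z) ⟧)                          ≤⟨ ∑-mono V (λ {v} _ → split v) ⟩
      ∑ V (λ v → ⟦ v Finₚ.≟ z ⟧ + ⟦ v ∈? Z ⟧)               ≡⟨ ∑-+ V _ _ ⟩
      ∑ V (λ v → ⟦ v Finₚ.≟ z ⟧) + ∑ V (λ v → ⟦ v ∈? Z ⟧)   ≤⟨ +-mono-≤ once (∑∈≤length Z) ⟩
      suc (length Z)                                        ∎
      where
      open ≤-Reasoning
      V = allFin n
      split : ∀ v → ⟦ v ∈? (z ∷ Z) ⟧ ≤ ⟦ v Finₚ.≟ z ⟧ + ⟦ v ∈? Z ⟧
      split v with v ∈? (z ∷ Z)
      ... | no _ = z≤n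
      ... | yes (here refl) = ≤-trans (≤-reflexive (sym (⟦⟧-true (v Finₚ.≟ v) refl))) (m≤m+n _ _)
      ... | yes (there v∈)  = ≤-trans (≤-reflexive (sym (⟦⟧-true (v ∈? Z) v∈))) (m≤n+m _ _)
      once : ∑ V (λ v → ⟦ v Finₚ.≟ z ⟧) ≤ 1
      once = begin
        ∑ V (λ v → ⟦ v Finₚ.≟ z ⟧)                    ≡⟨ ∑-↭ _ V↭ ⟩
        ⟦ z Finₚ.≟ z ⟧ + ∑ V′ (λ v → ⟦ v Finₚ.≟ z ⟧)
          ≤⟨ +-mono-≤ (⟦⟧≤1 (z Finₚ.≟ z)) (∑-mono V′ λ {v} v∈ → ⟦⟧-mono (v Finₚ.≟ z) (no id) (λ { refl → Uniqueₚ.Unique[x∷xs]⇒x∉xs u v∈ })) ⟩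
        1 + ∑ V′ (λ _ → 0)                            ≡⟨ cong suc (trans (∑-const V′ 0) (*-zeroʳ (length V′))) ⟩
        1                                             ∎
        where
        V′ = proj₁ (∈-↭ (∈-allFin z))
        V↭ = proj₂ (∈-↭ (∈-allFin z))
        u  = Unique-↭ V↭ (Uniqueₚ.allFin⁺ n)

    Fresh : List (Fin n) → List (Fin n) → Set
    Fresh Z l = All (_∉ Z) l × Unique l

    Fresh? : ∀ Z l → Dec (Fresh Z l)
    Fresh? Z l = All.all? (λ v → ¬? (v ∈? Z)) l ×-dec AllPairs.allPairs? (λ x y → ¬? (x Finₚ.≟ y)) l

    Fresh-++ : ∀ {Z} l {l′} → Fresh Z l → Fresh (l ++ Z) l′ → Fresh Z (l ++ l′)
    Fresh-++ l (l∉Z , u) (l′∉ , u′) =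
      Allₚ.++⁺ l∉Z (All.map (_∘ ∈-++⁺ʳ l) l′∉) ,
      Uniqueₚ.++⁺ u u′ (λ { (x∈l , x∈l′) → All.lookup l′∉ x∈l′ (∈-++⁺ˡ x∈l) })

  -- Absorbing blocks and their density.

  module AbsorberConstants (k c : ℕ) where

    r : ℕ
    r = suc k

    slotSize : ℕ
    slotSize = 2 + (k + (k + k))

    opaque
      blockSize : ℕ
      blockSize = r + r * slotSize

      blockSize≡ : blockSize ≡ r + r * slotSize
      blockSize≡ = refl

    -- A factor `c` for each of the two connecting vertices and `c ^ k` for each of the three tuples
    -- of a chain.
    slotDensity : ℕ
    slotDensity = c * (c * (c ^ k * (c ^ k * c ^ k)))

    opaque
      blockDensity : ℕ
      blockDensity = c ^ r * slotDensity ^ r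

  module Absorbers {n : ℕ} (G : Digraph n) (k s g c : ℕ) where

    open Cones G
    open AbsorberConstants k c public

    V : List (Fin n)
    V = allFin n

    mindeg : Fin n → ℕ
    mindeg x = D⁺ V x ⊓ D⁻ V x

    infix 4 _~_

    -- The better sides of `x` and `z` together miss at most `2s - 2rg` vertices, which leaves room
    -- for tuples completing both to a tile.
    _~_ : Fin n → Fin n → Set
    x ~ z = mindeg x + mindeg z + 2 * (r * g) ≤ 2 * s

    -- Half of the bound in `_~_`, so that any two moderate vertices are related.
    Moderate : Fin n → Set
    Moderate x = mindeg x + r * g ≤ s

    Joins : Fin n → Fin n → Vec (Fin n) k → Set
    Joins x z S = Cone (toList S) × Attach x (toList S) × Attach z (toList S)

    Joins? : ∀ x z S → Dec (Joins x z S)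
    Joins? x z S = Cone? (toList S) ×-dec (Attach? x (toList S) ×-dec Attach? z (toList S))

    -- A chain exchanges u for y: the copies q + S₁, q′ + S₂, y + S₃ of T_r give way to
    -- u + S₁, q + S₂, q′ + S₃.
    Slot : Set
    Slot = Fin n × Fin n × Vec (Fin n) k × Vec (Fin n) k × Vec (Fin n) k

    Chain : Fin n → Fin n → Slot → Set
    Chain u y (q , q′ , S₁ , S₂ , S₃) = Joins u q S₁ × Joins q q′ S₂ × Joins q′ y S₃

    Chain? : ∀ u y sl → Dec (Chain u y sl)
    Chain? u y (q , q′ , S₁ , S₂ , S₃) = Joins? u q S₁ ×-dec (Joins? q q′ S₂ ×-dec Joins? q′ y S₃)

    slotVertices : Slot → List (Fin n)
    slotVertices (q , q′ , S₁ , S₂ , S₃) = q ∷ q′ ∷ toList S₁ ++ toList S₂ ++ toList S₃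

    Chains : ∀ {j} → Vec (Fin n) j → Vec (Fin n) j → Vec Slot j → Set
    Chains []       []       []         = ⊤
    Chains (u ∷ us) (y ∷ ys) (sl ∷ sls) = Chain u y sl × Chains us ys sls

    Chains? : ∀ {j} (us ys : Vec (Fin n) j) sls → Dec (Chains us ys sls)
    Chains? []       []       []         = yes tt
    Chains? (u ∷ us) (y ∷ ys) (sl ∷ sls) = Chain? u y sl ×-dec Chains? us ys sls

    slotsVertices : ∀ {j} → Vec Slot j → List (Fin n)
    slotsVertices []         = []
    slotsVertices (sl ∷ sls) = slotVertices sl ++ slotsVertices sls

    Block : Set
    Block = Vec (Fin n) r × Vec Slot r

    blockVertices : Block → List (Fin n)
    blockVertices (ys , sls) = toList ys ++ slotsVertices sls

    Absorbs : Vec (Fin n) r → Block → Set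
    Absorbs us (ys , sls) = Cone (toList ys) × Chains us ys sls

    Absorbs? : ∀ us b → Dec (Absorbs us b)
    Absorbs? us (ys , sls) = Cone? (toList ys) ×-dec Chains? us ys sls

    Joins-tileable : ∀ {x z} S → Joins x z S →
      Tileable r (x ∷ toList S) × Tileable r (z ∷ toList S)
    Joins-tileable S (cone , attx , attz) =
      Cone⇒Tileable _ (cong suc (Vecₚ.length-toList S)) (attx , cone) ,
      Cone⇒Tileable _ (cong suc (Vecₚ.length-toList S)) (attz , cone)

    Chain-tileable : ∀ {u y} sl → Chain u y sl →
      Tileable r (u ∷ slotVertices sl) × Tileable r (y ∷ slotVertices sl)
    Chain-tileable {u} {y} (q , q′ , S₁ , S₂ , S₃) (j₁ , j₂ , j₃) =
      Tileable-↭ (↭-solve 6 (λ u q q′ a b c → (u ⊕ a) ⊕ (q ⊕ b) ⊕ (q′ ⊕ c) ⊜ u ⊕ q ⊕ q′ ⊕ a ⊕ b ⊕ c) ↭-refl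
        [ u ] [ q ] [ q′ ] (toList S₁) (toList S₂) (toList S₃))
        (Tileable-++ (proj₁ (Joins-tileable S₁ j₁)) (Tileable-++ (proj₁ (Joins-tileable S₂ j₂)) (proj₁ (Joins-tileable S₃ j₃)))) ,
      Tileable-↭ (↭-solve 6 (λ y q q′ a b c → (q ⊕ a) ⊕ (q′ ⊕ b) ⊕ (y ⊕ c) ⊜ y ⊕ q ⊕ q′ ⊕ a ⊕ b ⊕ c) ↭-refl
        [ y ] [ q ] [ q′ ] (toList S₁) (toList S₂) (toList S₃))
        (Tileable-++ (proj₂ (Joins-tileable S₁ j₁)) (Tileable-++ (proj₂ (Joins-tileable S₂ j₂)) (proj₂ (Joins-tileable S₃ j₃))))

    Chains-tileable : ∀ {j} (us ys : Vec (Fin n) j) sls → Chains us ys sls →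
      Tileable r (toList us ++ slotsVertices sls) × Tileable r (toList ys ++ slotsVertices sls)
    Chains-tileable []       []       []         _        = Tileable-[] , Tileable-[]
    Chains-tileable (u ∷ us) (y ∷ ys) (sl ∷ sls) (ch , chs) =
      Tileable-↭ (regroup u us) (Tileable-++ (proj₁ (Chain-tileable sl ch)) (proj₁ (Chains-tileable us ys sls chs))) ,
      Tileable-↭ (regroup y ys) (Tileable-++ (proj₂ (Chain-tileable sl ch)) (proj₂ (Chains-tileable us ys sls chs)))
      where
      regroup : ∀ x (xs : Vec (Fin n) _) →
        (x ∷ slotVertices sl) ++ (toList xs ++ slotsVertices sls) ↭ (x ∷ toList xs) ++ slotVertices sl ++ slotsVertices sls
      regroup x xs = ↭-solve 4 (λ x a xs b → (x ⊕ a) ⊕ (xs ⊕ b) ⊜ (x ⊕ xs) ⊕ a ⊕ b) ↭-refl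
        [ x ] (slotVertices sl) (toList xs) (slotsVertices sls)

    -- With `us` present, the chains take in `us` and release `ys`, which is a tile by itself;
    -- otherwise the chains are tiled together with `ys`.
    Absorbs-tileable : ∀ {us} b → Absorbs us b →
      Tileable r (toList us ++ blockVertices b) × Tileable r (blockVertices b)
    Absorbs-tileable {us} (ys , sls) (cone , chs) =
      Tileable-↭ (↭-solve 3 (λ u y s → y ⊕ (u ⊕ s) ⊜ u ⊕ (y ⊕ s)) ↭-refl (toList us) (toList ys) (slotsVertices sls))
        (Tileable-++ (Cone⇒Tileable (toList ys) (Vecₚ.length-toList ys) cone) (proj₁ (Chains-tileable us ys sls chs))) ,
      proj₂ (Chains-tileable us ys sls chs)

    length-slot : ∀ sl → length (slotVertices sl) ≡ slotSize
    length-slot (_ , _ , S₁ , S₂ , S₃) = cong (2 +_)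
      (trans (Listₚ.length-++ (toList S₁)) (cong₂ _+_ (Vecₚ.length-toList S₁)
        (trans (Listₚ.length-++ (toList S₂)) (cong₂ _+_ (Vecₚ.length-toList S₂) (Vecₚ.length-toList S₃)))))

    length-slots : ∀ {j} (sls : Vec Slot j) → length (slotsVertices sls) ≡ j * slotSize
    length-slots []         = refl
    length-slots (sl ∷ sls) = trans (Listₚ.length-++ (slotVertices sl)) (cong₂ _+_ (length-slot sl) (length-slots sls))

    opaque
      unfolding blockSize

      length-block : ∀ b → length (blockVertices b) ≡ blockSize
      length-block (ys , sls) = trans (Listₚ.length-++ (toList ys))
        (cong₂ _+_ (Vecₚ.length-toList ys) (length-slots sls))

    slots : List Slot
    slots = cartesianProductWith _,_ V (cartesianProductWith _,_ V (cartesianProductWith _,_ L (cartesianProductWith _,_ L L)))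
      where L = vecs k V

    blocks : List Block
    blocks = cartesianProductWith _,_ (vecs r V) (vecs r slots)

    record Hypotheses : Set where
      field
        ore   : ∀ {x y} → x ≢ y → ¬ x ⟶ y → D⁺ V x + D⁻ V y + 2 * (r * g) ≤ 2 * s
        n≡rs  : n ≡ r * s
        n≤cg  : n ≤ c * g
        0<k   : 0 < k
        0<g   : 0 < g
        2rg≤s : 2 * (r * g) ≤ s

    module _ (H : Hypotheses) where

      open Hypotheses H

      ore₀ : Ore V (2 * s)
      ore₀ _ _ x≢y x↛y = ≤-trans (m≤m+n _ _) (ore x≢y x↛y)

      length-V : length V ≡ n
      length-V = Listₚ.length-tabulate id

      V-unique : Unique V
      V-unique = Uniqueₚ.allFin⁺ n

      Good : List (Fin n) → Fin n → Set
      Good P v = D⁺ P v ≤ s + g ⊎ D⁻ P v ≤ s + g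

      Good? : ∀ P v → Dec (Good P v)
      Good? P v = (D⁺ P v ≤? s + g) ⊎-dec (D⁻ P v ≤? s + g)

      -- The vertices that are not good form a clique, so each of them has at most one
      -- non-neighbour outside the set of good vertices.
      many-good : ∀ P → P ⊑ V → g ≤ length P → g ≤ length (filter (Good? P) P)
      many-good P P⊑V g≤P = decidable-stable (g ≤? length F) λ g≰F → absurd (≰⇒> g≰F)
        where
        open ≤-Reasoning
        F  = filter (Good? P) P
        Bd = filter (¬? ∘ Good? P) P
        absurd : ¬ length F < g
        absurd F<g = <-irrefl refl (begin-strict
          s + g                 <⟨ proj₁ (bad (here refl)) ⟩
          D⁺ P v                ≡⟨ ∑-↭ _ (↭-partition (Good? P) P) ⟩
          D⁺ (F ++ Bd) v        ≡⟨ ∑-++ F Bd _ ⟩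
          D⁺ F v + D⁺ Bd v      ≤⟨ +-mono-≤ (∑≤length F) (≤-trans (≤-reflexive (∑-↭ _ Bd↭)) (+-mono-≤ (⟦⟧≤1 (¬? (v ⟶? v))) none)) ⟩
          length F + 1          ≡⟨ +-comm (length F) 1 ⟩
          suc (length F)        ≤⟨ F<g ⟩
          g                     ≤⟨ m≤n+m g s ⟩
          s + g                 ∎)
          where
          0<Bd : 0 < length Bd
          0<Bd = +-cancelˡ-< (length F) 0 (length Bd) (begin-strict
            length F + 0          ≡⟨ +-identityʳ _ ⟩
            length F              <⟨ F<g ⟩
            g                     ≤⟨ g≤P ⟩
            length P              ≡⟨ length-partition (Good? P) P ⟩
            length F + length Bd  ∎)
          -- The minimum of a constant function: an arbitrary element of `Bd`.
          some : ∃[ v ] v ∈ Bd × (∀ {y} → y ∈ Bd → 0 ≤ 0)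
          some = minimum Bd (λ _ → 0) 0<Bd
          v   = proj₁ some
          Bd′ = proj₁ (∈-↭ (proj₁ (proj₂ some)))
          Bd↭ : Bd ↭ v ∷ Bd′
          Bd↭ = proj₂ (∈-↭ (proj₁ (proj₂ some)))
          ∈Bd : ∀ {x} → x ∈ v ∷ Bd′ → x ∈ P × ¬ Good P x
          ∈Bd x∈ = ∈-filter⁻ (¬? ∘ Good? P) {xs = P} (↭ₚ.∈-resp-↭ (↭-sym Bd↭) x∈)
          bad : ∀ {x} → x ∈ v ∷ Bd′ → s + g < D⁺ P x × s + g < D⁻ P x
          bad x∈ = ≰⇒> (proj₂ (∈Bd x∈) ∘ inj₁) , ≰⇒> (proj₂ (∈Bd x∈) ∘ inj₂)
          u : Unique (v ∷ Bd′)
          u = Unique-↭ Bd↭ (⊑-Unique (⊑-trans (⊑-filter (¬? ∘ Good? P) P) P⊑V) V-unique)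
          ∑≤length : ∀ xs → D⁺ xs v ≤ length xs
          ∑≤length xs = ≤-trans (∑-mono xs (λ {y} _ → ⟦⟧≤1 (¬? (v ⟶? y))))
            (≤-reflexive (trans (∑-const xs 1) (*-identityʳ _)))
          v⟶ : ∀ {y} → y ∈ Bd′ → v ⟶ y
          v⟶ {y} y∈ = decidable-stable (v ⟶? y) λ v↛y → <-irrefl refl (begin-strict
            2 * s               ≡⟨ cong (s +_) (+-identityʳ s) ⟩
            s + s               ≤⟨ +-mono-≤ (m≤m+n s g) (m≤m+n s g) ⟩
            (s + g) + (s + g)   <⟨ +-mono-< (proj₁ (bad (here refl))) (proj₂ (bad (there y∈))) ⟩
            D⁺ P v + D⁻ P y     ≤⟨ ⊑-Ore P⊑V ore₀ (proj₁ (∈Bd (here refl))) (proj₁ (∈Bd (there y∈)))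
                                     (λ { refl → Uniqueₚ.Unique[x∷xs]⇒x∉xs u y∈ }) v↛y ⟩
            2 * s               ∎)
          none : D⁺ Bd′ v ≤ 0
          none = begin
            D⁺ Bd′ v            ≤⟨ ∑-mono Bd′ (λ {y} y∈ → ⟦⟧-mono (¬? (v ⟶? y)) (no id) (λ v↛y → v↛y (v⟶ y∈))) ⟩
            ∑ Bd′ (λ _ → 0)     ≡⟨ trans (∑-const Bd′ 0) (*-zeroʳ (length Bd′)) ⟩
            0                   ∎

      -- Each vertex is chosen among at least `g` good ones, which is a `1 / c` fraction of all
      -- vertices, and its choice excludes at most `s + g` later candidates. The last choice
      -- excludes nothing more, hence the `+ s`.
      cones-dense : ∀ j P → P ⊑ V → j * (s + g) ≤ length P + s →
        Dense (c ^ j) (vecs j V) (λ l → Cone (toList l) × All (_∈ P) (toList l))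
      cones-dense zero    P _   _    = Dense-[] {xs = V} (tt , [])
      cones-dense (suc j) P P⊑V size =
        Dense-× {b = c} {b′ = c ^ j} {Q = λ v → v ∈ P × Good P v}
          (Dense-⊑ {ys = F} (⊑-trans (⊑-filter (Good? P) P) P⊑V) (∈-filter⁻ (Good? P) {xs = P})
            (≤-trans (≤-reflexive length-V) (≤-trans n≤cg (*-monoʳ-≤ c (many-good P P⊑V g≤P)))))
          λ v (v∈ , good) → [ (λ d → extend′ v v∈ (v ⟶?_) inj₁ d) , (λ d → extend′ v v∈ (_⟶? v) inj₂ d) ]′ good
        where
        F = filter (Good? P) P
        size′ : j * (s + g) + g ≤ length P
        size′ = ≤-by size 0 (combine j s g (length P))
          where
          combine : ∀ j s g p → j * (s + g) + g + (p + s) + 0 ≡ p + suc j * (s + g)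
          combine = solve-∀
        g≤P : g ≤ length P
        g≤P = ≤-trans (m≤n+m g _) size′
        extend′ : ∀ v → v ∈ P → {A : Fin n → Set} (A? : Decidable A) → (∀ {l} → All A l → Attach v l) →
          ∑ P (λ y → ⟦ ¬? (A? y) ⟧) ≤ s + g →
          Dense (c ^ j) (vecs j V) (λ l → Cone (v ∷ toList l) × All (_∈ P) (v ∷ toList l))
        extend′ v v∈ A? attach few = Dense-mono
          (λ { (cone , all) → (attach (All.map (λ x∈ → proj₂ (∈-filter⁻ A? {xs = P} x∈)) all) , cone) ,
                              v∈ ∷ All.map (λ x∈ → proj₁ (∈-filter⁻ A? {xs = P} x∈)) all })
          (cones-dense j P′ (⊑-trans (⊑-filter A? P) P⊑V) size″)
          where
          P′ = filter A? P
          size″ : j * (s + g) ≤ length P′ + s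
          size″ = ≤-by (+-mono-≤ (+-mono-≤ size′ (≤-reflexive (length-partition A? P)))
                                 (≤-trans (≤-reflexive (length-filter (¬? ∘ A?) P)) few))
                    0 (combine (j * (s + g)) g s (length P) (length P′) (length (filter (¬? ∘ A?) P)))
            where
            combine : ∀ a g s p p′ x → a + (p + (p′ + x) + (s + g)) + 0 ≡ p′ + s + (a + g + p + x)
            combine = solve-∀

      size-avoiding : ∀ {F} Z → F ⊑ V → length F ≤ length (filter (λ v → ¬? (v ∈? Z)) F) + length Z
      size-avoiding {F} Z F⊑V = begin
        length F
          ≡⟨ length-partition (λ v → ¬? (v ∈? Z)) F ⟩
        length (filter (λ v → ¬? (v ∈? Z)) F) + length (filter (λ v → ¬? (¬? (v ∈? Z))) F)
          ≤⟨ +-monoʳ-≤ _ (begin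
            length (filter (λ v → ¬? (¬? (v ∈? Z))) F)   ≡⟨ length-filter (λ v → ¬? (¬? (v ∈? Z))) F ⟩
            ∑ F (λ v → ⟦ ¬? (¬? (v ∈? Z)) ⟧)             ≤⟨ ⊑-∑ _ F⊑V ⟩
            ∑ V (λ v → ⟦ ¬? (¬? (v ∈? Z)) ⟧)             ≤⟨ ∑-mono V (λ {v} _ → ⟦⟧-mono (¬? (¬? (v ∈? Z))) (v ∈? Z) (decidable-stable (v ∈? Z))) ⟩
            ∑ V (λ v → ⟦ v ∈? Z ⟧)                       ≤⟨ ∑∈≤length Z ⟩
            length Z                                     ∎) ⟩
        length (filter (λ v → ¬? (v ∈? Z)) F) + length Z ∎
        where open ≤-Reasoning

      -- The neighbourhood of `x` in its better direction, in a form that treats out- and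
      -- in-neighbours alike.
      Side : Fin n → Set₁
      Side x = Σ[ A ∈ (Fin n → Set) ] Σ[ A? ∈ Decidable A ]
        (∑ V (λ v → ⟦ ¬? (A? v) ⟧) ≤ mindeg x × (∀ {l} → All A l → Attach x l))

      side : ∀ x → Side x
      side x with ≤-total (D⁺ V x) (D⁻ V x)
      ... | inj₁ ≤D⁻ = (x ⟶_) , (x ⟶?_) , ≤-reflexive (sym (m≤n⇒m⊓n≡m ≤D⁻)) , inj₁
      ... | inj₂ ≤D⁺ = (_⟶ x) , (_⟶? x) , ≤-reflexive (sym (m≥n⇒m⊓n≡n ≤D⁺)) , inj₂

      -- The common neighbourhood on the better sides, minus `Z`, has at least `rs - (2s - 2rg) - g`
      -- vertices, enough for a cone on `k = r - 1` of them.
      joins-dense : ∀ {x z} Z → x ~ z → length Z ≤ g →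
        Dense (c ^ k) (vecs k V) (λ S → Joins x z S × Fresh Z (toList S))
      joins-dense {x} {z} Z x~z Z≤g = joining (side x) (side z)
        where
        joining : Side x → Side z → Dense (c ^ k) (vecs k V) (λ S → Joins x z S × Fresh Z (toList S))
        joining (A , A? , few , attx) (B , B? , few′ , attz) = Dense-mono
          (λ {S} (cone , all) → (cone , attx (All.map (proj₁ ∘ in-P) all) , attz (All.map (proj₁ ∘ proj₂ ∘ in-P) all)) ,
                                 All.map (proj₂ ∘ proj₂ ∘ in-P) all , Cone⇒Unique (toList S) cone)
          (cones-dense k P (⊑-trans (⊑-filter _ P₁) P₁⊑V) size)
          where
          open ≤-Reasoning
          AB? : ∀ v → Dec (A v × B v)
          AB? v = A? v ×-dec B? v
          P₁ = filter AB? V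
          P  = filter (λ v → ¬? (v ∈? Z)) P₁
          P₁⊑V : P₁ ⊑ V
          P₁⊑V = ⊑-filter AB? V
          in-P : ∀ {v} → v ∈ P → A v × B v × v ∉ Z
          in-P v∈ with ∈-filter⁻ (λ v → ¬? (v ∈? Z)) {xs = P₁} v∈
          ... | v∈P₁ , v∉Z with proj₂ (∈-filter⁻ AB? {xs = V} v∈P₁)
          ...   | a , b = a , b , v∉Z
          missing : length (filter (¬? ∘ AB?) V) ≤ mindeg x + mindeg z
          missing = begin
            length (filter (¬? ∘ AB?) V)                              ≡⟨ length-filter (¬? ∘ AB?) V ⟩
            ∑ V (λ v → ⟦ ¬? (AB? v) ⟧)                                ≤⟨ ∑-mono V (λ {v} _ → split v) ⟩
            ∑ V (λ v → ⟦ ¬? (A? v) ⟧ + ⟦ ¬? (B? v) ⟧)                 ≡⟨ ∑-+ V _ _ ⟩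
            ∑ V (λ v → ⟦ ¬? (A? v) ⟧) + ∑ V (λ v → ⟦ ¬? (B? v) ⟧)     ≤⟨ +-mono-≤ few few′ ⟩
            mindeg x + mindeg z                                       ∎
            where
            split : ∀ v → ⟦ ¬? (AB? v) ⟧ ≤ ⟦ ¬? (A? v) ⟧ + ⟦ ¬? (B? v) ⟧
            split v with A? v | B? v
            ... | yes _ | yes _ = z≤n
            ... | yes _ | no  _ = ≤-refl
            ... | no  _ | yes _ = ≤-refl
            ... | no  _ | no  _ = s≤s z≤n
          size : k * (s + g) ≤ length P + s
          size = ≤-by (+-mono-≤ (+-mono-≤ (+-mono-≤ (+-mono-≤ (+-mono-≤
              (≤-reflexive (trans (sym (trans length-V n≡rs)) (length-partition AB? V))) missing)
              (size-avoiding Z P₁⊑V)) x~z) Z≤g) (z≤n {g}))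
            (k * g) (combine k s g (length P₁) (length (filter (¬? ∘ AB?) V)) (mindeg x + mindeg z) (length P) (length Z))
            where
            combine : ∀ k s g p₁ x d p z →
              k * (s + g) + (p₁ + x + d + (p + z) + 2 * s + g + g) + k * g
              ≡ p + s + (suc k * s + x + p₁ + (d + 2 * (suc k * g)) + z + 0)
            combine = solve-∀

      -- The Ore condition bounds the sum of the two minima by `2s - 2rg`; `x` takes more than half
      -- of it, so less than half is left for `q`.
      immoderate : ∀ {x q} → ¬ Moderate x → q ≢ x → ¬ x ⟶ q → x ~ q × Moderate q
      immoderate {x} {q} ¬mod q≢x x↛q = x~q , ≤-by (+-mono-≤ x~q (<⇒≤ (≰⇒> ¬mod))) 0 (combine (mindeg x) (mindeg q) (r * g) s)
        where
        x~q : x ~ q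
        x~q = ≤-trans (+-monoˡ-≤ (2 * (r * g)) (+-mono-≤ (m⊓n≤m (D⁺ V x) (D⁻ V x)) (m⊓n≤n (D⁺ V q) (D⁻ V q)))) (ore (q≢x ∘ sym) x↛q)
        combine : ∀ x q a s → q + a + (2 * s + (x + a)) + 0 ≡ s + (x + q + 2 * a + s)
        combine = solve-∀

      moderate~ : ∀ {x z} → Moderate x → Moderate z → x ~ z
      moderate~ {x} {z} mx mz = ≤-by (+-mono-≤ mx mz) 0 (combine (mindeg x) (mindeg z) (r * g) s)
        where
        combine : ∀ x z a s → x + z + 2 * a + (s + s) + 0 ≡ 2 * s + (x + a + (z + a))
        combine = solve-∀

      Moderate? : ∀ x → Dec (Moderate x)
      Moderate? x = mindeg x + r * g ≤? s

      -- Candidates for the connecting vertex next to `u` in a chain.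
      Partners : Fin n → Set
      Partners u = ∃[ F ] F ⊑ V × (∀ {q} → q ∈ F → u ~ q × Moderate q) × s ≤ length F + r * g

      -- An immoderate vertex has more than `s - rg` non-out-neighbours, all covered by `immoderate`
      -- except `x` itself, whose removal is paid for by strictness.
      non-out-neighbours : ∀ {x} → ¬ Moderate x → Partners x
      non-out-neighbours {x} ¬mod = N′ , N′⊑V ,
        (λ q∈ → immoderate ¬mod (λ { refl → Uniqueₚ.Unique[x∷xs]⇒x∉xs u q∈ })
          (proj₂ (∈-filter⁻ (λ v → ¬? (x ⟶? v)) {xs = V} (↭ₚ.∈-resp-↭ (↭-sym N↭) (there q∈))))) ,
        s≤s⁻¹ (begin
          suc s                       ≤⟨ ≰⇒> ¬mod ⟩
          mindeg x + r * g            ≤⟨ +-monoˡ-≤ (r * g) (m⊓n≤m (D⁺ V x) (D⁻ V x)) ⟩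
          D⁺ V x + r * g              ≡⟨ cong (_+ r * g) (sym (length-filter (λ v → ¬? (x ⟶? v)) V)) ⟩
          length N + r * g            ≡⟨ cong (_+ r * g) (↭ₚ.↭-length N↭) ⟩
          suc (length N′ + r * g)     ∎)
        where
        open ≤-Reasoning
        N = filter (λ v → ¬? (x ⟶? v)) V
        N⊑V : N ⊑ V
        N⊑V = ⊑-filter (λ v → ¬? (x ⟶? v)) V
        x∈N : x ∈ N
        x∈N = ∈-filter⁺ (λ v → ¬? (x ⟶? v)) (∈-allFin x) irreflexive
        N′ = proj₁ (∈-↭ x∈N)
        N↭ : N ↭ x ∷ N′
        N↭ = proj₂ (∈-↭ x∈N)
        N′⊑V : N′ ⊑ V
        N′⊑V = ⊑-trans ([ x ] , ↭-trans N↭ (↭ₚ.++-comm [ x ] N′)) N⊑V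
        u : Unique (x ∷ N′)
        u = Unique-↭ N↭ (⊑-Unique N⊑V V-unique)

      -- A moderate `u` is related to all moderate vertices, so many of these suffice: either every
      -- vertex is moderate, or some immoderate vertex supplies its non-neighbours.
      partners : ∀ u → Partners u
      partners u with Moderate? u
      ... | no ¬mod = non-out-neighbours ¬mod
      ... | yes mod with All.all? Moderate? V
      ...   | yes all = V , ⊑-refl , (λ q∈ → moderate~ mod (All.lookup all q∈) , All.lookup all q∈) ,
                        ≤-trans (≤-trans (m≤m+n s _) (≤-reflexive (sym (trans length-V n≡rs)))) (m≤m+n _ _)
      ...   | no ¬all with find (Allₚ.¬All⇒Any¬ Moderate? V ¬all)
      ...     | x , _ , ¬modx with non-out-neighbours ¬modx
      ...       | F , F⊑V , props , size =
        F , F⊑V , (λ q∈ → moderate~ mod (proj₂ (props q∈)) , proj₂ (props q∈)) , size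

      partners-dense : ∀ u Z → length Z ≤ g → Dense c V (λ q → (u ~ q × Moderate q) × q ∉ Z)
      partners-dense u Z Z≤g with partners u
      ... | F , F⊑V , props , s≤ = Dense-⊑ {ys = F′} (⊑-trans (⊑-filter _ F) F⊑V)
        (λ q∈ → props (proj₁ (∈-filter⁻ (λ v → ¬? (v ∈? Z)) {xs = F} q∈)) , proj₂ (∈-filter⁻ (λ v → ¬? (v ∈? Z)) {xs = F} q∈))
        (≤-trans (≤-reflexive length-V) (≤-trans n≤cg (*-monoʳ-≤ c g≤F′)))
        where
        F′ = filter (λ v → ¬? (v ∈? Z)) F
        -- At least `s - rg ≥ rg ≥ 2g` candidates, of which `Z` takes at most `g`.
        g≤F′ : g ≤ length F′
        g≤F′ = ≤-by (+-mono-≤ (+-mono-≤ (+-mono-≤ (+-mono-≤ s≤ (size-avoiding Z F⊑V)) Z≤g) 2rg≤s)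
                    (*-monoˡ-≤ g (s≤s 0<k)))
                 0 (combine s (length F) (r * g) (length F′) (length Z) g)
          where
          combine : ∀ s f a f′ z g → g + (f + a + (f′ + z) + g + s + a) + 0 ≡ f′ + (s + f + z + 2 * a + 2 * g)
          combine = solve-∀

      -- Any `u` and `y` are linked: `u ~ q` and `y ~ q′` by choice, and `q ~ q′` because both are
      -- moderate. Every choice avoids `Z` and all earlier ones.
      slot-dense : ∀ u y Z → length Z + slotSize ≤ g →
        Dense slotDensity slots (λ sl → Chain u y sl × Fresh Z (slotVertices sl))
      slot-dense u y Z Z≤g =
        Dense-× (partners-dense u Z (≤-trans (m≤m+n _ _) Z≤g)) λ q ((u~q , mq) , q∉) →
        Dense-× (partners-dense y (q ∷ Z) (bound₁ Z≤g)) λ q′ ((y~q′ , mq′) , q′∉) →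
        Dense-× (joins-dense (q′ ∷ q ∷ Z) u~q (bound₂ Z≤g)) λ S₁ (j₁ , f₁) →
        Dense-× (joins-dense (toList S₁ ++ q′ ∷ q ∷ Z) (moderate~ mq mq′) (bound₃ S₁ Z≤g)) λ S₂ (j₂ , f₂) →
        Dense-mono (λ {S₃} (j₃ , f₃) → (j₁ , j₂ , j₃) ,
          Fresh-++ [ q ] (q∉ ∷ [] , [] ∷ []) (Fresh-++ [ q′ ] (q′∉ ∷ [] , [] ∷ [])
            (Fresh-++ (toList S₁) f₁ (Fresh-++ (toList S₂) f₂ f₃))))
          (joins-dense (toList S₂ ++ toList S₁ ++ q′ ∷ q ∷ Z) (~-sym y~q′) (bound₄ S₁ S₂ Z≤g))
        where
        ~-sym : ∀ {x z} → x ~ z → z ~ x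
        ~-sym {x} {z} x~z = subst (λ d → d + 2 * (r * g) ≤ 2 * s) (+-comm (mindeg x) (mindeg z)) x~z
        bound₁ : length Z + slotSize ≤ g → suc (length Z) ≤ g
        bound₁ h = ≤-by h (suc (k + (k + k))) (combine (length Z) k g)
          where
          combine : ∀ z k g → suc z + g + suc (k + (k + k)) ≡ g + (z + (2 + (k + (k + k))))
          combine = solve-∀
        bound₂ : length Z + slotSize ≤ g → suc (suc (length Z)) ≤ g
        bound₂ h = ≤-by h (k + (k + k)) (combine (length Z) k g)
          where
          combine : ∀ z k g → suc (suc z) + g + (k + (k + k)) ≡ g + (z + (2 + (k + (k + k))))
          combine = solve-∀
        bound₃ : ∀ S₁ {q q′} → length Z + slotSize ≤ g → length (toList {n = k} S₁ ++ q′ ∷ q ∷ Z) ≤ g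
        bound₃ S₁ h = ≤-trans (≤-reflexive (trans (Listₚ.length-++ (toList S₁)) (cong (_+ suc (suc (length Z))) (Vecₚ.length-toList S₁))))
          (≤-by h (k + k) (combine (length Z) k g))
          where
          combine : ∀ z k g → k + suc (suc z) + g + (k + k) ≡ g + (z + (2 + (k + (k + k))))
          combine = solve-∀
        bound₄ : ∀ S₁ S₂ {q q′} → length Z + slotSize ≤ g → length (toList {n = k} S₂ ++ toList {n = k} S₁ ++ q′ ∷ q ∷ Z) ≤ g
        bound₄ S₁ S₂ h = ≤-trans (≤-reflexive (trans (Listₚ.length-++ (toList S₂)) (cong₂ _+_ (Vecₚ.length-toList S₂)
            (trans (Listₚ.length-++ (toList S₁)) (cong (_+ suc (suc (length Z))) (Vecₚ.length-toList S₁))))))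
          (≤-by h k (combine (length Z) k g))
          where
          combine : ∀ z k g → k + (k + suc (suc z)) + g + k ≡ g + (z + (2 + (k + (k + k))))
          combine = solve-∀

      slots-dense : ∀ {j} (us ys : Vec (Fin n) j) Z → length Z + j * slotSize ≤ g →
        Dense (slotDensity ^ j) (vecs j slots) (λ sls → Chains us ys sls × Fresh Z (slotsVertices sls))
      slots-dense []       []       Z _   = Dense-[] {xs = slots} (tt , [] , [])
      slots-dense {suc j} (u ∷ us) (y ∷ ys) Z Z≤g =
        Dense-× (slot-dense u y Z (≤-trans (+-monoʳ-≤ (length Z) (m≤m+n slotSize _)) Z≤g)) λ sl (ch , f) →
        Dense-mono (λ {sls} (chs , f′) → (ch , chs) , Fresh-++ (slotVertices sl) f f′)
          (slots-dense us ys (slotVertices sl ++ Z) (≤-trans (≤-reflexive (size sl)) Z≤g))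
        where
        size : ∀ sl → length (slotVertices sl ++ Z) + j * slotSize ≡ length Z + suc j * slotSize
        size sl = trans (cong (_+ j * slotSize) (trans (Listₚ.length-++ (slotVertices sl)) (cong (_+ length Z) (length-slot sl))))
          (combine slotSize (length Z) (j * slotSize))
          where
          combine : ∀ a z b → a + z + b ≡ z + (a + b)
          combine = solve-∀

      opaque
        unfolding blockSize blockDensity

        -- The tile `ys` is chosen independently of `us`, since chains link any two vertices; so the
        -- density is the same for all `us`.
        blocks-dense : ∀ us Z → length Z + blockSize ≤ g →
          Dense blockDensity blocks (λ b → Absorbs us b × Fresh Z (blockVertices b))
        blocks-dense us Z Z≤g =
          Dense-× (cones-dense r P (⊑-filter (λ v → ¬? (v ∈? Z)) V) size) λ ys (cone , all) →
          Dense-mono (λ {sls} (chs , f) → (cone , chs) ,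
              Fresh-++ (toList ys) (All.map (λ v∈ → proj₂ (∈-filter⁻ (λ v → ¬? (v ∈? Z)) {xs = V} v∈)) all , Cone⇒Unique _ cone) f)
            (slots-dense us ys (toList ys ++ Z) (≤-trans (≤-reflexive (size′ ys)) Z≤g))
          where
          P : List (Fin n)
          P = filter (λ v → ¬? (v ∈? Z)) V
          size : r * (s + g) ≤ length P + s
          size = ≤-by (+-mono-≤ (+-mono-≤ (+-mono-≤ (≤-trans (≤-reflexive (sym (trans length-V n≡rs))) (size-avoiding Z ⊑-refl)) 2rg≤s)
                       (≤-trans (m≤m+n (length Z) _) Z≤g)) (*-monoˡ-≤ g (s≤s (z≤n {k}))))
                   0 (combine r s g (length P) (length Z))
            where
            combine : ∀ r s g p z → r * (s + g) + (p + z + s + g + r * g) + 0 ≡ p + s + (r * s + 2 * (r * g) + z + 1 * g)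
            combine = solve-∀
          size′ : ∀ (ys : Vec (Fin n) r) → length (toList ys ++ Z) + r * slotSize ≡ length Z + blockSize
          size′ ys = trans (cong (_+ r * slotSize) (trans (Listₚ.length-++ (toList ys)) (cong (_+ length Z) (Vecₚ.length-toList ys))))
            (combine r (length Z) (r * slotSize))
            where
            combine : ∀ a z b → a + z + b ≡ z + (a + b)
            combine = solve-∀

  -- Enumeration of tuples and elementary exponential inequalities.

  ∈-vecs : ∀ {k} {xs : List A} (v : Vec A k) → (∀ x → x ∈ xs) → v ∈ vecs k xs
  ∈-vecs []      _   = here refl
  ∈-vecs (x ∷ v) all = ∈-cartesianProductWith⁺ _∷_ (all x) (∈-vecs v all)

  length-vecs : ∀ k (xs : List A) → length (vecs k xs) ≡ length xs ^ k
  length-vecs zero    xs = refl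
  length-vecs (suc k) xs = trans (length-cartesianProductWith _∷_ xs (vecs k xs)) (cong (length xs *_) (length-vecs k xs))

  split-vec : ∀ k (xs : List A) → k ≤ length xs → Σ[ v ∈ Vec A k ] ∃[ ys ] xs ≡ toList v ++ ys
  split-vec zero    xs       _     = [] , xs , refl
  split-vec (suc k) (x ∷ xs) (s≤s k≤) with split-vec k xs k≤
  ... | v , ys , refl = x ∷ v , ys , refl

  chunks : ∀ k t (xs : List A) → length xs ≡ t * k →
    Σ[ vs ∈ List (Vec A k) ] length vs ≡ t × xs ≡ concatMap toList vs
  chunks k zero    []  _  = [] , refl , refl
  chunks k (suc t) xs eq with split-vec k xs (≤-trans (m≤m+n k _) (≤-reflexive (sym eq)))
  ... | v , ys , refl with chunks k t ys (+-cancelˡ-≡ k _ _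
          (trans (cong (_+ length ys) (sym (Vecₚ.length-toList v))) (trans (sym (Listₚ.length-++ (toList v))) eq)))
  ...   | vs , refl , refl = v ∷ vs , refl , refl

  -- Bernoulli's inequality `1 + m/d ≤ (1 + 1/d)^m` with denominators cleared.
  bernoulli : ∀ d m → (d + m) * d ^ m ≤ d * suc d ^ m
  bernoulli d zero    = ≤-reflexive (cong (_* 1) (+-identityʳ d))
  bernoulli d (suc m) = begin
    (d + suc m) * (d * d ^ m)     ≤⟨ ≤-by (z≤n {0}) (m * d ^ m) (expand d m (d ^ m)) ⟩
    suc d * ((d + m) * d ^ m)     ≤⟨ *-monoʳ-≤ (suc d) (bernoulli d m) ⟩
    suc d * (d * suc d ^ m)       ≡⟨ swap (suc d) d (suc d ^ m) ⟩
    d * (suc d * suc d ^ m)       ∎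
    where
    open ≤-Reasoning
    expand : ∀ d m p → (d + suc m) * (d * p) + 0 + m * p ≡ suc d * ((d + m) * p) + 0
    expand = solve-∀
    swap : ∀ a b c → a * (b * c) ≡ b * (a * c)
    swap = solve-∀

  2d^d≤[1+d]^d : ∀ d → 0 < d → 2 * d ^ d ≤ suc d ^ d
  2d^d≤[1+d]^d d 0<d = *-cancelˡ-≤ d {{>-nonZero 0<d}} (begin
    d * (2 * d ^ d)      ≡⟨ double d (d ^ d) ⟩
    (d + d) * d ^ d      ≤⟨ bernoulli d d ⟩
    d * suc d ^ d        ∎)
    where
    open ≤-Reasoning
    double : ∀ d p → d * (2 * p) ≡ (d + d) * p
    double = solve-∀

  2^-cancel-≤ : ∀ m n → 2 ^ m ≤ 2 ^ n → m ≤ n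
  2^-cancel-≤ m n 2^m≤2^n with m ≤? n
  ... | yes m≤n = m≤n
  ... | no  m≰n = contradiction (<-≤-trans (^-monoʳ-< 2 (s≤s (s≤s z≤n)) (≰⇒> m≰n)) 2^m≤2^n) (<-irrefl refl)

  0<^ : ∀ d m → 0 < d → 0 < d ^ m
  0<^ d m 0<d = m^n>0 d {{>-nonZero 0<d}} m

  ^-distribʳ-* : ∀ a b m → (a * b) ^ m ≡ a ^ m * b ^ m
  ^-distribʳ-* a b zero    = refl
  ^-distribʳ-* a b (suc m) = trans (cong (a * b *_) (^-distribʳ-* a b m)) (exchange a b (a ^ m) (b ^ m))
    where
    exchange : ∀ a b c d → a * b * (c * d) ≡ a * c * (b * d)
    exchange = solve-∀

  -- Selection by multiplicative weights.

  module Hitting {A B : Set} {H : A → B → Set} (H? : ∀ x y → Dec (H x y)) (ts : List A) (d : ℕ) (0<d : 0 < d) where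

    hits : List B → A → ℕ
    hits ys x = ∑ ys (λ y → ⟦ H? x y ⟧)

    -- `2` to the power of the number of entries of `ys` that miss `x`.
    wt : List B → A → ℕ
    wt []       x = 1
    wt (y ∷ ys) x = (2 ∸ ⟦ H? x y ⟧) * wt ys x

    total : List B → ℕ
    total ys = ∑ ts (wt ys)

    score : List B → B → ℕ
    score ys y = ∑ ts (λ x → wt ys x * ⟦ H? x y ⟧)

    wt-hits : ∀ ys x → wt ys x * 2 ^ hits ys x ≡ 2 ^ length ys
    wt-hits []       x = refl
    wt-hits (y ∷ ys) x with H? x y
    ... | yes _ = trans (regroup (wt ys x) (2 ^ hits ys x)) (cong (2 *_) (wt-hits ys x))
      where
      regroup : ∀ w p → (w + 0) * (2 * p) ≡ 2 * (w * p)
      regroup = solve-∀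
    ... | no  _ = trans (*-assoc 2 (wt ys x) _) (cong (2 *_) (wt-hits ys x))

    total-∷ : ∀ y ys → total (y ∷ ys) + score ys y ≡ 2 * total ys
    total-∷ y ys = trans (sym (∑-+ ts (wt (y ∷ ys)) _)) (trans (∑-cong ts pointwise) (∑-*ˡ ts 2 (wt ys)))
      where
      pointwise : ∀ x → (2 ∸ ⟦ H? x y ⟧) * wt ys x + wt ys x * ⟦ H? x y ⟧ ≡ 2 * wt ys x
      pointwise x with H? x y
      ... | yes _ = regroup (wt ys x)
        where
        regroup : ∀ w → w + 0 + w * 1 ≡ 2 * w
        regroup = solve-∀
      ... | no  _ = trans (cong (2 * wt ys x +_) (*-zeroʳ (wt ys x))) (+-identityʳ _)

    -- Relative to doubling, each selection loses at least a fraction `1 / suc d` of the total, so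
    -- `M` selections leave at most `(2d / (d + 1))^M` times the initial total `length ts`.
    Bounded : List B → Set
    Bounded ys = suc d ^ length ys * total ys ≤ (2 * d) ^ length ys * length ts

    Bounded-[] : Bounded []
    Bounded-[] = ≤-reflexive (cong (λ l → 1 * l) (trans (∑-const ts 1) (*-identityʳ (length ts))))

    Bounded-∷ : ∀ y ys → 2 * total ys ≤ suc d * score ys y → Bounded ys → Bounded (y ∷ ys)
    Bounded-∷ y ys large bounded = begin
      suc d * suc d ^ length ys * total (y ∷ ys)         ≡⟨ front (suc d) (suc d ^ length ys) (total (y ∷ ys)) ⟩
      suc d ^ length ys * (suc d * total (y ∷ ys))       ≤⟨ *-monoʳ-≤ (suc d ^ length ys) shrinks ⟩
      suc d ^ length ys * (2 * d * total ys)             ≡⟨ swap (suc d ^ length ys) (2 * d) (total ys) ⟩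
      2 * d * (suc d ^ length ys * total ys)             ≤⟨ *-monoʳ-≤ (2 * d) bounded ⟩
      2 * d * ((2 * d) ^ length ys * length ts)          ≡⟨ *-assoc (2 * d) _ _ ⟨
      2 * d * (2 * d) ^ length ys * length ts            ∎
      where
      open ≤-Reasoning
      front : ∀ a b c → a * b * c ≡ b * (a * c)
      front = solve-∀
      swap : ∀ a b c → a * (b * c) ≡ b * (a * c)
      swap = solve-∀
      shrinks : suc d * total (y ∷ ys) ≤ 2 * d * total ys
      shrinks = ≤-by (+-mono-≤ large (*-monoʳ-≤ (suc d) (≤-reflexive (total-∷ y ys)))) 0
        (combine d (total (y ∷ ys)) (total ys) (score ys y))
        where
        combine : ∀ d T T′ S → suc d * T + (suc d * S + suc d * (2 * T′)) + 0 ≡ 2 * d * T′ + (2 * T′ + suc d * (T + S))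
        combine = solve-∀

    -- With `M` selections and `h` hits, `x` alone has weight `2^(M - h)`, so `Bounded` yields
    -- `((d + 1)/d)^M ≤ 2^(t + h)`. For `M = 2dt` the left side is at least `2^(2t)`.
    often-hit : ∀ {t ys x} → length ys ≡ d * (2 * t) → length ts ≤ 2 ^ t → Bounded ys → x ∈ ts → t ≤ hits ys x
    often-hit {t} {ys} {x} len ts≤ bounded x∈ =
      +-cancelˡ-≤ t _ _ (≤-trans (≤-reflexive (cong (t +_) (sym (+-identityʳ t)))) (2^-cancel-≤ (2 * t) (t + h) (begin
        2 ^ (2 * t)                  ≤⟨ *-cancelˡ-≤ (d ^ M) {{>-nonZero (0<^ d M 0<d)}} (≤-trans (≤-trans lower (*-cancelˡ-≤ (2 ^ M) {{>-nonZero (0<^ 2 M (s≤s z≤n))}} upper)) (≤-reflexive (*-assoc (d ^ M) _ _))) ⟩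
        length ts * 2 ^ h            ≤⟨ *-monoˡ-≤ (2 ^ h) ts≤ ⟩
        2 ^ t * 2 ^ h                ≡⟨ ^-distribˡ-+-* 2 t h ⟨
        2 ^ (t + h)                  ∎)))
      where
      open ≤-Reasoning
      h = hits ys x
      M = length ys
      lower : d ^ M * 2 ^ (2 * t) ≤ suc d ^ M
      lower = begin
        d ^ M * 2 ^ (2 * t)                    ≡⟨ cong (λ l → d ^ l * 2 ^ (2 * t)) len ⟩
        d ^ (d * (2 * t)) * 2 ^ (2 * t)        ≡⟨ cong (_* 2 ^ (2 * t)) (sym (^-*-assoc d d (2 * t))) ⟩
        (d ^ d) ^ (2 * t) * 2 ^ (2 * t)        ≡⟨ ^-distribʳ-* (d ^ d) 2 (2 * t) ⟨
        (d ^ d * 2) ^ (2 * t)                  ≤⟨ ^-monoˡ-≤ (2 * t) (≤-trans (≤-reflexive (*-comm (d ^ d) 2)) (2d^d≤[1+d]^d d 0<d)) ⟩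
        (suc d ^ d) ^ (2 * t)                  ≡⟨ ^-*-assoc (suc d) d (2 * t) ⟩
        suc d ^ (d * (2 * t))                  ≡⟨ cong (suc d ^_) len ⟨
        suc d ^ M                              ∎
      upper : 2 ^ M * suc d ^ M ≤ 2 ^ M * (d ^ M * length ts * 2 ^ h)
      upper = begin
        2 ^ M * suc d ^ M                      ≡⟨ cong (_* suc d ^ M) (wt-hits ys x) ⟨
        wt ys x * 2 ^ h * suc d ^ M            ≡⟨ rotate (wt ys x) (2 ^ h) (suc d ^ M) ⟩
        suc d ^ M * wt ys x * 2 ^ h            ≤⟨ *-monoˡ-≤ (2 ^ h) (*-monoʳ-≤ (suc d ^ M) (∈-∑ (wt ys) x∈)) ⟩
        suc d ^ M * total ys * 2 ^ h           ≤⟨ *-monoˡ-≤ (2 ^ h) bounded ⟩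
        (2 * d) ^ M * length ts * 2 ^ h        ≡⟨ cong (λ z → z * length ts * 2 ^ h) (^-distribʳ-* 2 d M) ⟩
        2 ^ M * d ^ M * length ts * 2 ^ h      ≡⟨ assoc (2 ^ M) (d ^ M) (length ts) (2 ^ h) ⟩
        2 ^ M * (d ^ M * length ts * 2 ^ h)    ∎
        where
        rotate : ∀ a b c → a * b * c ≡ c * a * b
        rotate = solve-∀
        assoc : ∀ a b c e → a * b * c * e ≡ a * (b * c * e)
        assoc = solve-∀

  -- The reservoir of disjoint blocks and greedy absorption.

  positive-factorʳ : ∀ a {b} → 0 < a * b → 0 < b
  positive-factorʳ a {zero}  0<a*0 = contradiction (≤-trans 0<a*0 (≤-reflexive (*-zeroʳ a))) λ ()
  positive-factorʳ a {suc _} _     = s≤s z≤n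

  -- The origin of `d = 2D + 1`: a block that scores a `1 / D` share of the total weight makes the
  -- total shrink as `Bounded-∷` demands.
  double-≤ : ∀ {d D T F S} → d ≡ suc (2 * D) → T ≤ D * F → F ≤ S → 2 * T ≤ suc d * S
  double-≤ {D = D} {T} {F} {S} refl T≤ F≤S =
    ≤-by (+-mono-≤ (*-monoʳ-≤ 2 T≤) (*-monoʳ-≤ (2 * D) F≤S)) (2 * S) (combine D T F S)
    where
    combine : ∀ D T F S → 2 * T + (2 * (D * F) + 2 * D * S) + 2 * S ≡ suc (suc (2 * D)) * S + (2 * T + 2 * D * F)
    combine = solve-∀

  module Reservoir {n : ℕ} (G : Digraph n) (k s g c t d : ℕ) (d≡ : d ≡ suc (2 * AbsorberConstants.blockDensity k c)) where

    open Cones G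
    open Absorbers G k s g c renaming (Hypotheses to AbsorberHypotheses) public

    0<d : 0 < d
    0<d = subst (0 <_) (sym d≡) (s≤s z≤n)

    targets : List (Vec (Fin n) r)
    targets = vecs r V

    open Hitting {H = Absorbs} Absorbs? targets d 0<d public

    vertices : List Block → List (Fin n)
    vertices []       = []
    vertices (b ∷ bs) = blockVertices b ++ vertices bs

    -- A block that absorbs anything is also tileable alone, so the blocks left over at the end do
    -- no harm.
    Useful : Block → Set
    Useful b = ∃[ us ] Absorbs us b

    length-vertices : ∀ bs → length (vertices bs) ≡ length bs * blockSize
    length-vertices []       = refl
    length-vertices (b ∷ bs) = trans (Listₚ.length-++ (blockVertices b)) (cong₂ _+_ (length-block b) (length-vertices bs))

    vertices-↭ : ∀ {bs bs′} → bs ↭ bs′ → vertices bs ↭ vertices bs′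
    vertices-↭ ↭.refl = ↭-refl
    vertices-↭ (↭.prep b σ) = ↭ₚ.++⁺ˡ (blockVertices b) (vertices-↭ σ)
    vertices-↭ (↭.swap {bs} {bs′} b b′ σ) = ↭-trans
      (↭-solve 3 (λ x y z → x ⊕ (y ⊕ z) ⊜ y ⊕ (x ⊕ z)) ↭-refl (blockVertices b) (blockVertices b′) (vertices bs))
      (↭ₚ.++⁺ˡ (blockVertices b′) (↭ₚ.++⁺ˡ (blockVertices b) (vertices-↭ σ)))
    vertices-↭ (↭.trans σ τ) = ↭-trans (vertices-↭ σ) (vertices-↭ τ)

    Useful-tileable : ∀ bs → All Useful bs → Tileable r (vertices bs)
    Useful-tileable []       _                  = Tileable-[]
    Useful-tileable (b ∷ bs) ((us , abs) ∷ all) =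
      Tileable-++ (proj₂ (Absorbs-tileable {us} b abs)) (Useful-tileable bs all)

    -- Spending one block costs every remaining tuple at most one hit, so as many hits as there are
    -- tuples suffice.
    absorb : ∀ uss bs → All Useful bs → (∀ {us} → us ∈ uss → length uss ≤ hits bs us) →
      Tileable r (concatMap toList uss ++ vertices bs)
    absorb []         bs useful _  = Useful-tileable bs useful
    absorb (us ∷ uss) bs useful many =
      Tileable-↭ perm (Tileable-++ (proj₁ (Absorbs-tileable {us} b abs)) (absorb uss bs′ useful′ many′))
      where
      hit = ∑-positive bs (λ b → ⟦ Absorbs? us b ⟧) (≤-trans (s≤s z≤n) (many (here refl)))
      b   = proj₁ hit
      abs : Absorbs us b
      abs = ⟦⟧-positive (Absorbs? us b) (proj₂ (proj₂ hit))
      bs′ = proj₁ (∈-↭ (proj₁ (proj₂ hit)))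
      bs↭ : bs ↭ b ∷ bs′
      bs↭ = proj₂ (∈-↭ (proj₁ (proj₂ hit)))
      useful′ : All Useful bs′
      useful′ = All.tail (↭ₚ.All-resp-↭ bs↭ useful)
      many′ : ∀ {vs} → vs ∈ uss → length uss ≤ hits bs′ vs
      many′ {vs} vs∈ = s≤s⁻¹ (begin
        suc (length uss)                        ≤⟨ many (there vs∈) ⟩
        hits bs vs                              ≡⟨ ∑-↭ _ bs↭ ⟩
        ⟦ Absorbs? vs b ⟧ + hits bs′ vs         ≤⟨ +-monoˡ-≤ (hits bs′ vs) (⟦⟧≤1 (Absorbs? vs b)) ⟩
        suc (hits bs′ vs)                       ∎)
        where open ≤-Reasoning
      perm : (toList us ++ blockVertices b) ++ (concatMap toList uss ++ vertices bs′)
           ↭ (toList us ++ concatMap toList uss) ++ vertices bs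
      perm = ↭-trans
        (↭-solve 4 (λ u b us bs → (u ⊕ b) ⊕ (us ⊕ bs) ⊜ (u ⊕ us) ⊕ (b ⊕ bs)) ↭-refl
          (toList us) (blockVertices b) (concatMap toList uss) (vertices bs′))
        (↭ₚ.++⁺ˡ (toList us ++ concatMap toList uss) (↭-sym (vertices-↭ bs↭)))

    module _ (H : AbsorberHypotheses) where

      open AbsorberHypotheses H

      0<n : 0 < n
      0<n = ≤-trans (*-mono-≤ (s≤s (z≤n {k})) (≤-trans (≤-trans 0<g (≤-trans (m≤m+n g _) (m≤m+n (r * g) _))) 2rg≤s))
              (≤-reflexive (sym n≡rs))

      0<vecs : ∀ {A : Set} j (xs : List A) → 0 < length xs → 0 < length (vecs j xs)
      0<vecs j xs 0<xs = ≤-trans (0<^ (length xs) j 0<xs) (≤-reflexive (sym (length-vecs j xs)))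

      0<× : ∀ {A B : Set} (xs : List A) (ys : List B) → 0 < length xs → 0 < length ys →
        0 < length (cartesianProductWith _,_ xs ys)
      0<× xs ys 0<xs 0<ys = ≤-trans (*-mono-≤ 0<xs 0<ys) (≤-reflexive (sym (length-cartesianProductWith _,_ xs ys)))

      0<V : 0 < length V
      0<V = ≤-trans 0<n (≤-reflexive (sym (length-V H)))

      0<blocks : 0 < length blocks
      0<blocks = 0<× (vecs r V) (vecs r slots) (0<vecs r V 0<V) (0<vecs r slots
        (0<× V _ 0<V (0<× V _ 0<V (0<× L _ 0<L (0<× L L 0<L 0<L)))))
        where
        L   = vecs k V
        0<L = 0<vecs k V 0<V

      module Choice (bs : List Block) (room : length (vertices bs) + blockSize ≤ g) where

        Z = vertices bs

        FreshHit? : ∀ us b → Dec (Absorbs us b × Fresh Z (blockVertices b))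
        FreshHit? us b = Absorbs? us b ×-dec Fresh? Z (blockVertices b)

        -- Only blocks that avoid `Z` and repeat no vertex score, so a block with positive score is
        -- automatically disjoint from the earlier ones.
        freshScore : Block → ℕ
        freshScore b = ∑ targets (λ us → wt bs us * ⟦ FreshHit? us b ⟧)

        best = maximum blocks freshScore 0<blocks
        b    = proj₁ best

        -- Double counting: each target is absorbed by a `1 / blockDensity` fraction of all blocks
        -- through fresh ones, and the best block scores at least the average.
        total≤ : total bs ≤ blockDensity * freshScore b
        total≤ = *-cancelˡ-≤ (length blocks) {{>-nonZero 0<blocks}} (begin
          length blocks * total bs
            ≡⟨ ∑-*ˡ targets (length blocks) (wt bs) ⟨
          ∑ targets (λ us → length blocks * wt bs us)
            ≤⟨ ∑-mono targets (λ {us} _ → per-target us) ⟩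
          ∑ targets (λ us → blockDensity * ∑ blocks (λ b → wt bs us * ⟦ FreshHit? us b ⟧))
            ≡⟨ ∑-*ˡ targets blockDensity _ ⟩
          blockDensity * ∑ targets (λ us → ∑ blocks (λ b → wt bs us * ⟦ FreshHit? us b ⟧))
            ≡⟨ cong (blockDensity *_) (∑-comm targets blocks _) ⟩
          blockDensity * ∑ blocks freshScore
            ≤⟨ *-monoʳ-≤ blockDensity (∑-mono blocks (proj₂ (proj₂ best))) ⟩
          blockDensity * ∑ blocks (λ _ → freshScore b)
            ≡⟨ cong (blockDensity *_) (∑-const blocks (freshScore b)) ⟩
          blockDensity * (length blocks * freshScore b)
            ≡⟨ swap blockDensity (length blocks) (freshScore b) ⟩
          length blocks * (blockDensity * freshScore b) ∎)
          where
          open ≤-Reasoning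
          swap : ∀ a b c → a * (b * c) ≡ b * (a * c)
          swap = solve-∀
          per-target : ∀ us → length blocks * wt bs us ≤ blockDensity * ∑ blocks (λ b → wt bs us * ⟦ FreshHit? us b ⟧)
          per-target us = Dense.weigh (blocks-dense H us Z room) (λ b → wt bs us * ⟦ FreshHit? us b ⟧) (wt bs us)
            (λ b hit → ≤-reflexive (sym (trans (cong (wt bs us *_) (⟦⟧-true (FreshHit? us b) hit)) (*-identityʳ _))))

        0<wt : ∀ bs us → 0 < wt bs us
        0<wt []       us = s≤s z≤n
        0<wt (b ∷ bs) us = *-mono-≤ (m<n⇒0<n∸m (s≤s (⟦⟧≤1 (Absorbs? us b)))) (0<wt bs us)

        0<total : 0 < total bs
        0<total = begin
          1                          ≤⟨ 0<vecs r V 0<V ⟩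
          length targets             ≡⟨ *-identityʳ _ ⟨
          length targets * 1         ≡⟨ ∑-const targets 1 ⟨
          ∑ targets (λ _ → 1)        ≤⟨ ∑-mono targets (λ {us} _ → 0<wt bs us) ⟩
          total bs                   ∎
          where open ≤-Reasoning

        0<freshScore : 0 < freshScore b
        0<freshScore = positive-factorʳ blockDensity (≤-trans 0<total total≤)

        chosen : ∃[ us ] Absorbs us b × Fresh Z (blockVertices b)
        chosen = us , ⟦⟧-positive (FreshHit? us b) (positive-factorʳ (wt bs us) (proj₂ (proj₂ scoring)))
          where
          scoring = ∑-positive targets (λ us → wt bs us * ⟦ FreshHit? us b ⟧) 0<freshScore
          us      = proj₁ scoring

        freshScore≤score : freshScore b ≤ score bs b
        freshScore≤score = ∑-mono targets (λ {us} _ →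
          *-monoʳ-≤ (wt bs us) (⟦⟧-mono (FreshHit? us b) (Absorbs? us b) proj₁))

        large : 2 * total bs ≤ suc d * score bs b
        large = double-≤ {d} {blockDensity} {total bs} {freshScore b} {score bs b} d≡ total≤ freshScore≤score

      family : ∀ M → M * blockSize ≤ g →
        ∃[ bs ] length bs ≡ M × Unique (vertices bs) × All Useful bs × Bounded bs
      family zero    _    = [] , refl , [] , [] , Bounded-[]
      family (suc M) size with family M (≤-trans (m≤n+m (M * blockSize) blockSize) size)
      ... | bs , len , u , useful , bounded =
        b ∷ bs , cong suc len ,
        Uniqueₚ.++⁺ (proj₂ fresh) u (λ { (x∈ , x∈′) → All.lookup (proj₁ fresh) x∈ x∈′ }) ,
        (proj₁ chosen , proj₁ (proj₂ chosen)) ∷ useful ,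
        Bounded-∷ b bs large bounded
        where
        open Choice bs (≤-trans (≤-reflexive (trans (cong (_+ blockSize) (trans (length-vertices bs) (cong (_* blockSize) len))) (+-comm _ blockSize))) size)
        fresh = proj₂ (proj₂ chosen)

      reservoir : d * (2 * t) * blockSize ≤ g → n ^ r ≤ 2 ^ t →
        ∃[ bs ] length bs ≡ d * (2 * t) × Unique (vertices bs) × All Useful bs × (∀ us → t ≤ hits bs us)
      reservoir size n^r≤2^t with family (d * (2 * t)) size
      ... | bs , len , u , useful , bounded = bs , len , u , useful , λ us →
        often-hit {ys = bs} len (≤-trans (≤-reflexive (trans (length-vecs r V) (cong (_^ r) (length-V H)))) n^r≤2^t) bounded (∈-vecs us ∈-allFin)

  -- Lists of distinct elements as sublists, and exponential against polynomial growth.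

  Unique⇒⊑ : ∀ {X : List A} l → Unique l → (∀ {x} → x ∈ l → x ∈ X) → l ⊑ X
  Unique⇒⊑ {X = X} []      _        _   = X , ↭-refl
  Unique⇒⊑ {X = X} (x ∷ l) (x∉ ∷ u) sub = proj₁ rest , ↭-trans X↭ (↭-prep x (proj₂ rest))
    where
    X′ = proj₁ (∈-↭ (sub (here refl)))
    X↭ : X ↭ x ∷ X′
    X↭ = proj₂ (∈-↭ (sub (here refl)))
    sub′ : ∀ {z} → z ∈ l → z ∈ X′
    sub′ z∈ with ↭ₚ.∈-resp-↭ X↭ (sub (there z∈))
    ... | here refl = contradiction refl (All.lookup x∉ z∈)
    ... | there z∈′ = z∈′
    rest = Unique⇒⊑ l u sub′

  1+n≤2^n : ∀ n → suc n ≤ 2 ^ n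
  1+n≤2^n zero    = s≤s z≤n
  1+n≤2^n (suc n) = begin
    suc (suc n)        ≤⟨ ≤-by (z≤n {0}) n (expand n) ⟩
    2 * suc n          ≤⟨ *-monoʳ-≤ 2 (1+n≤2^n n) ⟩
    2 * 2 ^ n          ∎
    where
    open ≤-Reasoning
    expand : ∀ n → suc (suc n) + 0 + n ≡ 2 * suc n + 0
    expand = solve-∀

  -- At exponent `3a` it follows from the cube of `1 + a ≤ 2^a`; afterwards the left side at most
  -- doubles when `i` grows by one.
  linear≤2^ : ∀ a i → a * suc (3 * a + i) ≤ 2 ^ (3 * a + i)
  linear≤2^ a zero    = begin
    a * suc (3 * a + 0)              ≤⟨ ≤-by (z≤n {0}) (a * a * a + 2 * a + 1) (expand a) ⟩
    suc a * (suc a * (suc a * 1))    ≤⟨ ^-monoˡ-≤ 3 (1+n≤2^n a) ⟩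
    (2 ^ a) ^ 3                      ≡⟨ ^-*-assoc 2 a 3 ⟩
    2 ^ (a * 3)                      ≡⟨ cong (2 ^_) (trans (*-comm a 3) (sym (+-identityʳ (3 * a)))) ⟩
    2 ^ (3 * a + 0)                  ∎
    where
    open ≤-Reasoning
    expand : ∀ a → a * suc (3 * a + 0) + 0 + (a * a * a + 2 * a + 1) ≡ suc a * (suc a * (suc a * 1)) + 0
    expand = solve-∀
  linear≤2^ a (suc i) = begin
    a * suc (3 * a + suc i)          ≤⟨ ≤-by (z≤n {0}) (a * (3 * a + i)) (expand a i) ⟩
    2 * (a * suc (3 * a + i))        ≤⟨ *-monoʳ-≤ 2 (linear≤2^ a i) ⟩
    2 * 2 ^ (3 * a + i)              ≡⟨ cong (2 ^_) (+-suc (3 * a) i) ⟨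
    2 ^ (3 * a + suc i)              ∎
    where
    open ≤-Reasoning
    expand : ∀ a i → a * suc (3 * a + suc i) + 0 + a * (3 * a + i) ≡ 2 * (a * suc (3 * a + i)) + 0
    expand = solve-∀

  -- In effect an `r`-th root is taken: with `q = t / r` rounded down, `t ≤ r * suc q`, and
  -- `c * r * suc q ≤ 2 ^ q` is the linear case.
  polynomial≤2^ : ∀ r .{{_ : NonZero r}} c → ∃[ t₀ ] ∀ t → t₀ ≤ t → (c * t) ^ r ≤ 2 ^ t
  polynomial≤2^ r c = 3 * e * r , bound
    where
    open ≤-Reasoning
    e = c * r
    bound : ∀ t → 3 * e * r ≤ t → (c * t) ^ r ≤ 2 ^ t
    bound t t₀≤t = begin
      (c * t) ^ r          ≤⟨ ^-monoˡ-≤ r (*-monoʳ-≤ c t≤) ⟩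
      (c * (r * suc q)) ^ r  ≡⟨ cong (_^ r) (sym (*-assoc c r (suc q))) ⟩
      (e * suc q) ^ r      ≤⟨ ^-monoˡ-≤ r e[1+q]≤ ⟩
      (2 ^ q) ^ r          ≡⟨ ^-*-assoc 2 q r ⟩
      2 ^ (q * r)          ≤⟨ ^-monoʳ-≤ 2 (m/n*n≤m t r) ⟩
      2 ^ t                ∎
      where
      q = t / r
      3e≤q : 3 * e ≤ q
      3e≤q = ≤-trans (≤-reflexive (sym (m*n/n≡m (3 * e) r))) (/-monoˡ-≤ r t₀≤t)
      e[1+q]≤ : e * suc q ≤ 2 ^ q
      e[1+q]≤ = subst (λ q → e * suc q ≤ 2 ^ q) (m+[n∸m]≡n 3e≤q) (linear≤2^ e (q ∸ 3 * e))
      t≤ : t ≤ r * suc q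
      t≤ = begin
        t                ≡⟨ m≡m%n+[m/n]*n t r ⟩
        t % r + q * r    ≤⟨ +-monoˡ-≤ (q * r) (<⇒≤ (m%n<n t r)) ⟩
        r + q * r        ≡⟨ *-comm (suc q) r ⟩
        r * suc q        ∎

  -- The reservoir has g = scale * t vertices and absorbs t leftover tiles.
  module Constants (k K : ℕ) where

    opaque
      -- Chosen for `n ≤ c * g`: rounding down costs at most a factor `2`, so `s ≤ 2 * (r * K * g)`,
      -- and `n = r * s`.
      c : ℕ
      c = 2 * (suc k * suc k * K)

      c≡ : c ≡ 2 * (suc k * suc k * K)
      c≡ = refl

    open AbsorberConstants k c public

    opaque
      -- `scale` is the number of reservoir vertices per leftover tile, coming from `d * (2 * t)`
      -- blocks. `c₂` gives `n ≤ c₂ * t`, from which `y` and `E₀` are made to satisfy `y-large` and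
      -- `E₀-large`.
      d scale c₂ y E₀ : ℕ
      d     = suc (2 * blockDensity)
      scale = d * 2 * blockSize
      c₂    = c * scale
      y     = 3 * c₂
      E₀    = (2 * (r * r) + 1) * (c₂ * c₂ * c₂ * c₂)

      d≡ : d ≡ suc (2 * blockDensity)
      d≡ = refl

      scale≡ : scale ≡ d * 2 * blockSize
      scale≡ = refl

      c₂≡ : c₂ ≡ c * scale
      c₂≡ = refl

      y≡ : y ≡ 3 * c₂
      y≡ = refl

      E₀≡ : E₀ ≡ (2 * (r * r) + 1) * (c₂ * c₂ * c₂ * c₂)
      E₀≡ = refl

    open NibbleConstants r E₀ y public

    -- With `t = s / D`, the reservoir size `g` is about `s / (r * K)`. The bound `t₀` collects all
    -- demands on `t`: the exponential beats `n ^ r`, `t` is positive, and both largeness conditions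
    -- of the almost tiling hold.
    D t₀ n₀ : ℕ
    D  = r * K * scale
    t₀ = proj₁ (polynomial≤2^ r c₂) + (1 + (c * E₁ + (m * m * κ + 3 * E₁)))
    n₀ = r * (t₀ * D)

  -- Assembly: reservoir, almost tiling, absorption.

  module Tiling {n : ℕ} (G : Digraph n) (k K : ℕ) (0<k : 0 < k) (2≤K : 2 ≤ K) where

    open Cones G
    open Constants k K

    0<r : 0 < r
    0<r = s≤s z≤n

    0<K : 0 < K
    0<K = ≤-trans (s≤s z≤n) 2≤K

    0<scale : 0 < scale
    0<scale = subst (0 <_) (sym scale≡) (*-mono-≤ (*-mono-≤ (subst (0 <_) (sym d≡) (s≤s z≤n)) (s≤s (z≤n {1})))
      (subst (0 <_) (sym blockSize≡) (≤-trans 0<r (m≤m+n r _))))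

    0<c : 0 < c
    0<c = subst (0 <_) (sym c≡) (*-mono-≤ (s≤s (z≤n {1})) (*-mono-≤ (*-mono-≤ 0<r 0<r) 0<K))

    0<c₂ : 0 < c₂
    0<c₂ = subst (0 <_) (sym c₂≡) (*-mono-≤ 0<c 0<scale)

    0<y : 0 < y
    0<y = subst (0 <_) (sym y≡) (*-mono-≤ (s≤s (z≤n {2})) 0<c₂)

    0<D : 0 < D
    0<D = *-mono-≤ (*-mono-≤ 0<r 0<K) 0<scale

    -- The condition says `D⁺ + D⁻ ≤ 2s - 2s/K`, and `r * K * g ≤ s` turns the gap into the required
    -- `2 * (r * g)`.
    tiling : ∀ s → n₀ ≤ n → n ≡ r * s →
      (∀ {x y} → x ≢ y → ¬ x ⟶ y → K * (D⁺ (allFin n) x + D⁻ (allFin n) y) + 2 * s ≤ K * (2 * s)) →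
      Tileable r (allFin n)
    tiling s n₀≤n n≡rs ore = Tileable-↭ (↭-sym V↭) (Tileable-++ tileY absorbed)
      where
      open ≤-Reasoning
      instance
        D≢0 : NonZero D
        D≢0 = >-nonZero 0<D
      t = s / D
      g = scale * t

      t₀≤t : t₀ ≤ t
      t₀≤t = begin
        t₀              ≡⟨ m*n/n≡m t₀ D ⟨
        t₀ * D / D      ≤⟨ /-monoˡ-≤ D (*-cancelˡ-≤ r (≤-trans n₀≤n (≤-reflexive n≡rs))) ⟩
        t               ∎

      0<t : 0 < t
      0<t = ≤-trans (≤-trans (m≤m+n 1 _) (m≤n+m _ (proj₁ (polynomial≤2^ r c₂)))) t₀≤t

      cE₁≤t : c * E₁ ≤ t
      cE₁≤t = ≤-trans (≤-trans (≤-trans (m≤m+n _ _) (m≤n+m _ 1)) (m≤n+m _ (proj₁ (polynomial≤2^ r c₂)))) t₀≤t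

      mmC≤t : m * m * κ + 3 * E₁ ≤ t
      mmC≤t = ≤-trans (≤-trans (≤-trans (m≤n+m _ (c * E₁)) (m≤n+m _ 1)) (m≤n+m _ (proj₁ (polynomial≤2^ r c₂)))) t₀≤t

      rKg≤s : r * K * g ≤ s
      rKg≤s = begin
        r * K * (scale * t)   ≡⟨ regroup (r * K) scale t ⟩
        t * D                 ≤⟨ m/n*n≤m s D ⟩
        s                     ∎
        where
        regroup : ∀ a b t → a * (b * t) ≡ t * (a * b)
        regroup = solve-∀

      s≤2rKg : s ≤ 2 * (r * K * g)
      s≤2rKg = begin
        s                          ≡⟨ m≡m%n+[m/n]*n s D ⟩
        s % D + t * D              ≤⟨ +-monoˡ-≤ (t * D) (<⇒≤ (m%n<n s D)) ⟩
        D + t * D                  ≤⟨ +-monoˡ-≤ (t * D) (≤-trans (≤-reflexive (sym (*-identityˡ D))) (*-monoˡ-≤ D 0<t)) ⟩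
        t * D + t * D              ≡⟨ regroup (r * K) scale t ⟩
        2 * (r * K * (scale * t))  ∎
        where
        regroup : ∀ a b t → t * (a * b) + t * (a * b) ≡ 2 * (a * (b * t))
        regroup = solve-∀

      n≤cg : n ≤ c * g
      n≤cg = begin
        n                          ≡⟨ n≡rs ⟩
        r * s                      ≤⟨ *-monoʳ-≤ r s≤2rKg ⟩
        r * (2 * (r * K * g))      ≡⟨ regroup r K g ⟩
        2 * (r * r * K) * g        ≡⟨ cong (_* g) c≡ ⟨
        c * g                      ∎
        where
        regroup : ∀ r K g → r * (2 * (r * K * g)) ≡ 2 * (r * r * K) * g
        regroup = solve-∀

      n≤c₂t : n ≤ c₂ * t
      n≤c₂t = ≤-trans n≤cg (≤-reflexive (trans (sym (*-assoc c scale t)) (cong (_* t) (sym c₂≡))))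

      t≤g : t ≤ g
      t≤g = ≤-trans (≤-reflexive (sym (*-identityˡ t))) (*-monoˡ-≤ t 0<scale)

      0<g : 0 < g
      0<g = ≤-trans 0<t t≤g

      2rg≤s : 2 * (r * g) ≤ s
      2rg≤s = begin
        2 * (r * g)      ≤⟨ *-monoˡ-≤ (r * g) 2≤K ⟩
        K * (r * g)      ≡⟨ regroup K r g ⟩
        r * K * g        ≤⟨ rKg≤s ⟩
        s                ∎
        where
        regroup : ∀ K r g → K * (r * g) ≡ r * K * g
        regroup = solve-∀

      ore′ : ∀ {x y} → x ≢ y → ¬ x ⟶ y → D⁺ (allFin n) x + D⁻ (allFin n) y + 2 * (r * g) ≤ 2 * s
      ore′ {x} {y} x≢y x↛y = *-cancelˡ-≤ K {{>-nonZero 0<K}}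
        (≤-by (+-mono-≤ (ore x≢y x↛y) (*-monoʳ-≤ 2 rKg≤s)) 0 (combine K (D⁺ (allFin n) x + D⁻ (allFin n) y) r g s))
        where
        combine : ∀ K d r g s → K * (d + 2 * (r * g)) + (K * (2 * s) + 2 * s) + 0 ≡ K * (2 * s) + (K * d + 2 * s + 2 * (r * K * g))
        combine = solve-∀

      n^r≤2^t : n ^ r ≤ 2 ^ t
      n^r≤2^t = ≤-trans (^-monoˡ-≤ r n≤c₂t) (proj₂ (polynomial≤2^ r c₂) t (≤-trans (m≤m+n _ _) t₀≤t))

      module R = Reservoir G k s g c t d d≡

      absorberHypotheses : R.AbsorberHypotheses
      absorberHypotheses = record
        { ore = ore′ ; n≡rs = n≡rs ; n≤cg = n≤cg ; 0<k = 0<k ; 0<g = 0<g ; 2rg≤s = 2rg≤s }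

      reservoirSize : d * (2 * t) * blockSize ≡ g
      reservoirSize = trans (regroup d t blockSize) (cong (_* t) (sym scale≡))
        where
        regroup : ∀ d t b → d * (2 * t) * b ≡ d * 2 * b * t
        regroup = solve-∀

      res     = R.reservoir absorberHypotheses (≤-reflexive reservoirSize) n^r≤2^t
      bs      = proj₁ res
      Z       = R.vertices bs
      useful  = proj₁ (proj₂ (proj₂ (proj₂ res)))
      hit     = proj₂ (proj₂ (proj₂ (proj₂ res)))

      ∣Z∣ : length Z ≡ g
      ∣Z∣ = trans (R.length-vertices bs) (trans (cong (_* blockSize) (proj₁ (proj₂ res))) reservoirSize)

      Z⊑V : Z ⊑ allFin n
      Z⊑V = Unique⇒⊑ Z (proj₁ (proj₂ (proj₂ res))) (λ {x} _ → ∈-allFin x)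

      X₀  = proj₁ Z⊑V
      V↭Z++X₀ : allFin n ↭ Z ++ X₀
      V↭Z++X₀ = proj₂ Z⊑V

      n≡∣X₀∣+g : n ≡ length X₀ + g
      n≡∣X₀∣+g = trans (sym (Listₚ.length-tabulate id)) (trans (↭ₚ.↭-length V↭Z++X₀)
        (trans (Listₚ.length-++ Z) (trans (cong (_+ length X₀) ∣Z∣) (+-comm g _))))

      -- Every block has `r * suc slotSize` vertices, so the reservoir and hence `X₀` have size
      -- divisible by `r`.
      g′ = d * (2 * t) * suc slotSize

      g≡rg′ : g ≡ r * g′
      g≡rg′ = trans (sym reservoirSize) (trans (cong (d * (2 * t) *_) blockSize≡) (regroup (d * (2 * t)) r slotSize))
        where
        regroup : ∀ a r b → a * (r + r * b) ≡ r * (a * suc b)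
        regroup = solve-∀

      t+g′≤s : t + g′ ≤ s
      t+g′≤s = begin
        t + g′             ≤⟨ +-mono-≤ t≤g (≤-trans (m≤m+n g′ _) (≤-reflexive (sym g≡rg′))) ⟩
        g + g              ≤⟨ +-mono-≤ (m≤m+n g _) (m≤m+n g _) ⟩
        r * g + r * g      ≡⟨ cong (r * g +_) (sym (+-identityʳ _)) ⟩
        2 * (r * g)        ≤⟨ 2rg≤s ⟩
        s                  ∎

      -- The number of tiles to remove from `X₀` until exactly `t` tiles' worth of vertices remain.
      i = s ∸ (t + g′)

      ∣X₀∣ : length X₀ ≡ r * (t + i)
      ∣X₀∣ = +-cancelʳ-≡ g _ _ (begin-equality
        length X₀ + g            ≡⟨ n≡∣X₀∣+g ⟨
        n                        ≡⟨ n≡rs ⟩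
        r * s                    ≡⟨ cong (r *_) (m+[n∸m]≡n t+g′≤s) ⟨
        r * (t + g′ + i)         ≡⟨ regroup r t g′ i ⟩
        r * (t + i) + r * g′     ≡⟨ cong (r * (t + i) +_) g≡rg′ ⟨
        r * (t + i) + g          ∎)
        where
        regroup : ∀ r t g i → r * (t + g + i) ≡ r * (t + i) + r * g
        regroup = solve-∀

      module N = Nibble G r s g t E₀ y X₀

      0<n : 0 < n
      0<n = R.0<n absorberHypotheses

      nibbleHypotheses : N.Hypotheses
      nibbleHypotheses = record
        { ore      = ore′
        ; n≡rs     = n≡rs
        ; n≡p₀+g   = n≡∣X₀∣+g
        ; 2≤r      = s≤s 0<k
        ; 0<y      = 0<y
        ; 0<p₀     = ≤-trans (*-mono-≤ (s≤s (z≤n {k})) (≤-trans 0<t (m≤m+n t i))) (≤-reflexive (sym ∣X₀∣))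
        ; 0<Δ      = *-mono-≤ 0<t 0<g
        ; X₀⊑V     = Z , ↭-trans V↭Z++X₀ (↭ₚ.++-comm Z X₀)
        ; E₀-large = E₀-large
        ; nE₁≤Δ    = nE₁≤Δ
        ; y-large  = y-large
        }
        where
        E₀-large : κ * (n * n * n) * n ≤ E₀ * (t * g * (t * g))
        E₀-large = begin
          κ * (n * n * n) * n
            ≡⟨ *-assoc κ (n * n * n) n ⟩
          κ * (n * n * n * n)
            ≤⟨ *-monoʳ-≤ κ (*-mono-≤ (*-mono-≤ (*-mono-≤ n≤c₂t n≤c₂t) n≤c₂t) n≤c₂t) ⟩
          κ * (c₂ * t * (c₂ * t) * (c₂ * t) * (c₂ * t))
            ≡⟨ regroup κ c₂ t ⟩
          κ * (c₂ * c₂ * c₂ * c₂) * (t * t * (t * t))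
            ≡⟨ cong (_* (t * t * (t * t))) E₀≡ ⟨
          E₀ * (t * t * (t * t))
            ≤⟨ *-monoʳ-≤ E₀ (*-mono-≤ (*-monoʳ-≤ t t≤g) (*-monoʳ-≤ t t≤g)) ⟩
          E₀ * (t * g * (t * g)) ∎
          where
          regroup : ∀ κ c t → κ * (c * t * (c * t) * (c * t) * (c * t)) ≡ κ * (c * c * c * c) * (t * t * (t * t))
          regroup = solve-∀
        nE₁≤Δ : n * E₁ ≤ t * g
        nE₁≤Δ = begin
          n * E₁            ≤⟨ *-monoˡ-≤ E₁ n≤cg ⟩
          c * g * E₁        ≡⟨ regroup c g E₁ ⟩
          c * E₁ * g        ≤⟨ *-monoˡ-≤ g cE₁≤t ⟩
          t * g             ∎
          where
          regroup : ∀ c g E → c * g * E ≡ c * E * g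
          regroup = solve-∀
        y-large : m * m * κ + 2 * n + y * E₁ ≤ y * t
        y-large = begin
          m * m * κ + 2 * n + y * E₁
            ≤⟨ +-monoˡ-≤ (y * E₁) (+-mono-≤ (≤-trans (≤-reflexive (sym (*-identityˡ _))) (*-monoˡ-≤ (m * m * κ) 0<c₂)) (*-monoʳ-≤ 2 n≤c₂t)) ⟩
          c₂ * (m * m * κ) + 2 * (c₂ * t) + y * E₁
            ≡⟨ cong (λ y → c₂ * (m * m * κ) + 2 * (c₂ * t) + y * E₁) y≡ ⟩
          c₂ * (m * m * κ) + 2 * (c₂ * t) + 3 * c₂ * E₁
            ≡⟨ regroup c₂ (m * m * κ) t E₁ ⟩
          2 * (c₂ * t) + c₂ * (m * m * κ + 3 * E₁)
            ≤⟨ +-monoʳ-≤ (2 * (c₂ * t)) (*-monoʳ-≤ c₂ mmC≤t) ⟩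
          2 * (c₂ * t) + c₂ * t
            ≡⟨ regroup′ c₂ t ⟩
          3 * c₂ * t
            ≡⟨ cong (_* t) y≡ ⟨
          y * t ∎
          where
          regroup : ∀ c M t E → c * M + 2 * (c * t) + 3 * c * E ≡ 2 * (c * t) + c * (M + 3 * E)
          regroup = solve-∀
          regroup′ : ∀ c t → 2 * (c * t) + c * t ≡ 3 * c * t
          regroup′ = solve-∀

      almost = N.almost-tiling nibbleHypotheses i ∣X₀∣
      Y      = proj₁ almost
      U      = proj₁ (proj₂ almost)
      X₀↭    = proj₁ (proj₂ (proj₂ almost))
      tileY  = proj₁ (proj₂ (proj₂ (proj₂ almost)))
      ∣U∣    = proj₂ (proj₂ (proj₂ (proj₂ almost)))

      pieces = chunks r t U (trans ∣U∣ (*-comm r t))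
      uss    = proj₁ pieces

      absorbed : Tileable r (concatMap toList uss ++ Z)
      absorbed = R.absorb uss bs useful (λ {us} _ → ≤-trans (≤-reflexive (proj₁ (proj₂ pieces))) (hit us))

      V↭ : allFin n ↭ Y ++ (concatMap toList uss ++ Z)
      V↭ = ↭-trans V↭Z++X₀ (↭-trans (↭ₚ.++⁺ˡ Z (↭-trans X₀↭ (↭-reflexive (cong (Y ++_) (proj₂ (proj₂ pieces))))))
        (↭-solve 3 (λ z y u → z ⊕ (y ⊕ u) ⊜ y ⊕ (u ⊕ z)) ↭-refl Z Y (concatMap toList uss)))

  -- From lists of tiles to factors given by maps.

  AllPairs-lookup : ∀ {R : A → A → Set} {l} → AllPairs R l → ∀ {i j} → i Data.Fin.< j → R (lookup l i) (lookup l j)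
  AllPairs-lookup (x∼ ∷ _) {Fin.zero}  {Fin.suc j} _         = All.lookup x∼ (∈-lookup j)
  AllPairs-lookup (_ ∷ ps) {Fin.suc i} {Fin.suc j} (s≤s i<j) = AllPairs-lookup ps i<j

  lookup-injective : ∀ {l : List A} → Unique l → ∀ i j → lookup l i ≡ lookup l j → i ≡ j
  lookup-injective (_  ∷ _) Fin.zero    Fin.zero    _  = refl
  lookup-injective (x∉ ∷ _) Fin.zero    (Fin.suc j) eq = contradiction eq (All.lookup x∉ (∈-lookup j))
  lookup-injective (x∉ ∷ _) (Fin.suc i) Fin.zero    eq = contradiction (sym eq) (All.lookup x∉ (∈-lookup i))
  lookup-injective (_  ∷ u) (Fin.suc i) (Fin.suc j) eq = cong Fin.suc (lookup-injective u i j eq)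

  module TilesAsMaps {n : ℕ} (G : Digraph n) where

    open Cones G

    copy : ∀ {r ts} → All (Tile r) ts → Fin (length ts) → Fin r → Fin n
    copy              (_ ∷ tiles)      (Fin.suc c) i = copy tiles c i
    copy {ts = l ∷ _} ((refl , _) ∷ _) Fin.zero    i = lookup l i

    copy-IsTTCopy : ∀ {r ts} (tiles : All (Tile r) ts) c → IsTTCopy G r (copy tiles c)
    copy-IsTTCopy ((refl , tr) ∷ _) Fin.zero    i j i<j = AllPairs-lookup tr i<j
    copy-IsTTCopy (_ ∷ tiles)       (Fin.suc c) i j i<j = copy-IsTTCopy tiles c i j i<j

    copy-∈ : ∀ {r ts} (tiles : All (Tile r) ts) c i → copy tiles c i ∈ concat ts
    copy-∈ {ts = l ∷ _} ((refl , _) ∷ _) Fin.zero    i = ∈-++⁺ˡ {xs = l} (∈-lookup {xs = l} i)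
    copy-∈ {ts = l ∷ _} (_ ∷ tiles)      (Fin.suc c) i = ∈-++⁺ʳ l (copy-∈ tiles c i)

    copy-surjective : ∀ {r ts} (tiles : All (Tile r) ts) {v} → v ∈ concat ts →
      Σ[ c ∈ Fin (length ts) ] Σ[ i ∈ Fin r ] copy tiles c i ≡ v
    copy-surjective {ts = l ∷ ts} ((refl , _) ∷ tiles) v∈ with ∈-++⁻ l v∈
    ... | inj₁ v∈l = Fin.zero , Any.index v∈l , sym (Anyₚ.lookup-index v∈l)
    ... | inj₂ v∈ts with copy-surjective tiles v∈ts
    ...   | c , i , eq = Fin.suc c , i , eq

    copy-injective : ∀ {r ts} (tiles : All (Tile r) ts) → Unique (concat ts) → ∀ c c′ i i′ →
      copy tiles c i ≡ copy tiles c′ i′ → c ≡ c′ × i ≡ i′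
    copy-injective {ts = l ∷ ts} ((refl , _) ∷ tiles) u Fin.zero Fin.zero i i′ eq =
      refl , lookup-injective (⊑-Unique {X = l ++ concat ts} (concat ts , ↭-refl) u) i i′ eq
    copy-injective {ts = l ∷ ts} ((refl , _) ∷ tiles) u Fin.zero (Fin.suc c′) i i′ eq =
      ⊥-elim (disjoint l u (∈-lookup i) (subst (_∈ concat ts) (sym eq) (copy-∈ tiles c′ i′)))
      where
      disjoint : ∀ l {m} {x : Fin n} → Unique (l ++ m) → x ∈ l → x ∉ m
      disjoint (_ ∷ l) (x∉ ∷ _) (here refl) x∈m = All.lookup x∉ (∈-++⁺ʳ l x∈m) refl
      disjoint (_ ∷ l) (_ ∷ u)  (there x∈l) x∈m = disjoint l u x∈l x∈m
    copy-injective {ts = l ∷ ts} tiles@((refl , _) ∷ _) u (Fin.suc c) Fin.zero i i′ eq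
      with copy-injective tiles u Fin.zero (Fin.suc c) i′ i (sym eq)
    ... | () , _
    copy-injective {ts = l ∷ ts} (_ ∷ tiles) u (Fin.suc c) (Fin.suc c′) i i′ eq
      with copy-injective tiles (Unique-++⁻ʳ l u) c c′ i i′ eq
    ... | refl , i≡i′ = refl , i≡i′

    Tileable⇒HasTTFactor : ∀ {r} → Tileable r (allFin n) → HasTTFactor G r
    Tileable⇒HasTTFactor (ts , tiles , σ) =
      length ts , copy tiles , copy-IsTTCopy tiles ,
      copy-injective tiles (Unique-↭ (↭-sym σ) (Uniqueₚ.allFin⁺ n)) ,
      λ v → copy-surjective tiles (↭ₚ.∈-resp-↭ (↭-sym σ) (∈-allFin v))

  -- Translation of the rational degree condition.

  module _ {n : ℕ} (G : Digraph n) where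

    open Cones G

    D⁺+outdeg : ∀ x → D⁺ (allFin n) x + outdeg G x ≡ n
    D⁺+outdeg x = trans (go (allFin n)) (Listₚ.length-tabulate id)
      where
      go : ∀ xs → D⁺ xs x + sum (map (λ y → if adj G x y then 1 else 0) xs) ≡ length xs
      go []       = refl
      go (y ∷ xs) with adj G x y
      ... | true  = trans (+-suc _ _) (cong suc (go xs))
      ... | false = cong suc (go xs)

    D⁻+indeg : ∀ y → D⁻ (allFin n) y + indeg G y ≡ n
    D⁻+indeg y = trans (go (allFin n)) (Listₚ.length-tabulate id)
      where
      go : ∀ xs → D⁻ xs y + sum (map (λ x → if adj G x y then 1 else 0) xs) ≡ length xs
      go []       = refl
      go (x ∷ xs) with adj G x y
      ... | true  = trans (+-suc _ _) (cong suc (go xs))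
      ... | false = cong suc (go xs)

  -- The degree condition for η = P/Q with denominators cleared, Q = 1 + q and P = 1 + p.
  factor-of-cleared-condition : ∀ k → 0 < k → ∀ q p → ∃[ n₀ ] ∀ n s → n₀ ≤ n → n ≡ suc k * s → ∀ (G : Digraph n) →
    (∀ x y → x ≢ y → adj G x y ≡ false →
      2 * (k * suc q + suc p * suc k) * s ≤ (outdeg G x + indeg G y) * suc q) →
    HasTTFactor G (suc k)
  -- `K = Q + 1` serves for every `P ≥ 1`, and it is at least `2` even when `Q = 1`.
  factor-of-cleared-condition k 0<k q p = Constants.n₀ k (2 + q) , λ n s n₀≤n n≡ G deg →
    TilesAsMaps.Tileable⇒HasTTFactor G (Tiling.tiling G k (2 + q) 0<k (s≤s (s≤s z≤n)) s n₀≤n n≡ λ {x} {y} x≢y x↛y →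
      complement s {o = outdeg G x} {i = indeg G y} (D⁺+outdeg G x) (D⁻+indeg G y) n≡ (deg x y x≢y (Boolₚ.¬-not x↛y)))
    where
    complement : ∀ {n} s {d o d′ i} → d + o ≡ n → d′ + i ≡ n → n ≡ suc k * s →
      2 * (k * suc q + suc p * suc k) * s ≤ (o + i) * suc q → (2 + q) * (d + d′) + 2 * s ≤ (2 + q) * (2 * s)
    complement {n} s {d} {o} {d′} {i} d+o d′+i n≡ large =
      -- Passing from `Q` to `Q + 1` copies of `d + d′` costs at most `2rs`, by `0 ≤ o + i`; the gap
      -- `2Prs` pays for it.
      ≤-by (+-mono-≤ (+-mono-≤ large (≤-reflexive (cong (suc (suc q) *_) (trans (cong₂ _+_ d+o d′+i) (cong₂ _+_ n≡ n≡)))))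
                     (z≤n {o + i}))
           (2 * p * (suc k * s)) (combine k q p s d o d′ i)
      where
      combine : ∀ k q p s d o d′ i →
        suc (suc q) * (d + d′) + 2 * s + ((o + i) * suc q + suc (suc q) * (suc k * s + suc k * s) + (o + i)) + 2 * p * (suc k * s)
        ≡ suc (suc q) * (2 * s) + (2 * (k * suc q + suc p * suc k) * s + suc (suc q) * (d + o + (d′ + i)) + 0)
      combine = solve-∀

  -- Unnormalised rationals compute numerators and denominators literally, so the hypothesis becomes
  -- an inequality of integers; the common factor `r` then cancels because `n = r * s`.
  clear-denominators : ∀ k p q .(cop : Coprime (suc p) (suc q)) n s deg → n ≡ suc k * s →
    (ι 2 ℚ./ 1) ℚ.* ((ℚ.1ℚ ℚ.- (ι 1 ℚ./ suc k)) ℚ.+ mkℚ (ι suc p) q cop) ℚ.* (ι n ℚ./ 1) ℚ.≤ (ι deg ℚ./ 1) →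
    2 * (k * suc q + suc p * suc k) * s ≤ deg * suc q
  clear-denominators k p q cop n s deg n≡ h = cancel (ℤₚ.drop‿+≤+ (subst₂ ℤ._≤_ numerator (sym (ℤₚ.pos-* deg _)) cross))
    where
    η = mkℚ (ι suc p) q cop
    unnormalised : ∀ i d → ℚ.toℚᵘ (i ℚ./ suc d) ≃ mkℚᵘ i d
    unnormalised i d = ℚₚ.toℚᵘ-fromℚᵘ (mkℚᵘ i d)
    factor≃ : ℚ.toℚᵘ ((ℚ.1ℚ ℚ.- (ι 1 ℚ./ suc k)) ℚ.+ η) ≃ (mkℚᵘ (ι 1) 0 ℚᵘ.+ (ℚᵘ.- mkℚᵘ (ι 1) k)) ℚᵘ.+ mkℚᵘ (ι suc p) q
    factor≃ = ℚᵘₚ.≃-trans (ℚₚ.toℚᵘ-homo-+ (ℚ.1ℚ ℚ.- (ι 1 ℚ./ suc k)) η) (ℚᵘₚ.+-congˡ (ℚ.toℚᵘ η)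
      (ℚᵘₚ.≃-trans (ℚₚ.toℚᵘ-homo-+ ℚ.1ℚ (ℚ.- (ι 1 ℚ./ suc k))) (ℚᵘₚ.+-congʳ (mkℚᵘ (ι 1) 0)
        (ℚᵘₚ.≃-trans (ℚₚ.toℚᵘ-homo‿- (ι 1 ℚ./ suc k)) (ℚᵘₚ.-‿cong (unnormalised (ι 1) k))))))
    lhs≃ : ℚ.toℚᵘ ((ι 2 ℚ./ 1) ℚ.* ((ℚ.1ℚ ℚ.- (ι 1 ℚ./ suc k)) ℚ.+ η) ℚ.* (ι n ℚ./ 1)) ≃
      mkℚᵘ (ι 2) 0 ℚᵘ.* ((mkℚᵘ (ι 1) 0 ℚᵘ.+ (ℚᵘ.- mkℚᵘ (ι 1) k)) ℚᵘ.+ mkℚᵘ (ι suc p) q) ℚᵘ.* mkℚᵘ (ι n) 0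
    lhs≃ = ℚᵘₚ.≃-trans (ℚₚ.toℚᵘ-homo-* ((ι 2 ℚ./ 1) ℚ.* F) (ι n ℚ./ 1)) (ℚᵘₚ.*-cong
      (ℚᵘₚ.≃-trans (ℚₚ.toℚᵘ-homo-* (ι 2 ℚ./ 1) F) (ℚᵘₚ.*-cong (unnormalised (ι 2) 0) factor≃))
      (unnormalised (ι n) 0))
      where
      F : ℚ
      F = (ℚ.1ℚ ℚ.- (ι 1 ℚ./ suc k)) ℚ.+ η
    D : ℕ
    D = 1 * (1 * suc k * suc q) * 1
    cross : ι 2 ℤ.* ((ι 1 ℤ.* ι suc k ℤ.+ (ℤ.- ι 1) ℤ.* ι 1) ℤ.* ι suc q ℤ.+ ι suc p ℤ.* ι (1 * suc k)) ℤ.* ι n ℤ.* ι 1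
      ℤ.≤ ι deg ℤ.* ι D
    cross with ℚᵘₚ.≤-respˡ-≃ lhs≃ (ℚᵘₚ.≤-respʳ-≃ (unnormalised (ι deg) 0) (ℚₚ.toℚᵘ-mono-≤ h))
    ... | ℚᵘ.*≤* le = le
    numerator : ι 2 ℤ.* ((ι 1 ℤ.* ι suc k ℤ.+ (ℤ.- ι 1) ℤ.* ι 1) ℤ.* ι suc q ℤ.+ ι suc p ℤ.* ι (1 * suc k)) ℤ.* ι n ℤ.* ι 1
      ≡ ι (2 * (k * suc q + suc p * (1 * suc k)) * n)
    numerator = begin
      ι 2 ℤ.* ((ι 1 ℤ.* ι suc k ℤ.+ (ℤ.- ι 1) ℤ.* ι 1) ℤ.* ι suc q ℤ.+ ι suc p ℤ.* ι (1 * suc k)) ℤ.* ι n ℤ.* ι 1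
        ≡⟨ simplify (ι k) (ι suc q) (ι suc p ℤ.* ι (1 * suc k)) (ι n) ⟩
      ι 2 ℤ.* (ι k ℤ.* ι suc q ℤ.+ ι suc p ℤ.* ι (1 * suc k)) ℤ.* ι n
        ≡⟨ cong₂ (λ a b → ι 2 ℤ.* (a ℤ.+ b) ℤ.* ι n) (sym (ℤₚ.pos-* k (suc q))) (sym (ℤₚ.pos-* (suc p) (1 * suc k))) ⟩
      ι 2 ℤ.* ι (k * suc q + suc p * (1 * suc k)) ℤ.* ι n
        ≡⟨ cong (ℤ._* ι n) (sym (ℤₚ.pos-* 2 (k * suc q + suc p * (1 * suc k)))) ⟩
      ι (2 * (k * suc q + suc p * (1 * suc k))) ℤ.* ι n
        ≡⟨ sym (ℤₚ.pos-* (2 * (k * suc q + suc p * (1 * suc k))) n) ⟩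
      ι (2 * (k * suc q + suc p * (1 * suc k)) * n) ∎
      where
      open ≡-Reasoning
      simplify : ∀ k q b n → ι 2 ℤ.* ((ι 1 ℤ.* (ι 1 ℤ.+ k) ℤ.+ (ℤ.- ι 1) ℤ.* ι 1) ℤ.* q ℤ.+ b) ℤ.* n ℤ.* ι 1
        ≡ ι 2 ℤ.* (k ℤ.* q ℤ.+ b) ℤ.* n
      simplify = ℤ-Ring.solve-∀
    cancel : 2 * (k * suc q + suc p * (1 * suc k)) * n ≤ deg * D → 2 * (k * suc q + suc p * suc k) * s ≤ deg * suc q
    cancel le = *-cancelˡ-≤ (suc k) (subst₂ _≤_ (trans (cong (2 * (k * suc q + suc p * (1 * suc k)) *_) n≡) (lhs k q p s)) (rhs k q deg) le)
      where
      lhs : ∀ k q p s → 2 * (k * suc q + suc p * (1 * suc k)) * (suc k * s) ≡ suc k * (2 * (k * suc q + suc p * suc k) * s)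
      lhs = solve-∀
      rhs : ∀ k q deg → deg * (1 * (1 * suc k * suc q) * 1) ≡ suc k * (deg * suc q)
      rhs = solve-∀

  transitive-tournament-factor : ∀ (r : ℕ) .{{_ : NonZero r}} → 2 ≤ r → ∀ (η : ℚ) → ℚ.Positive η →
    ∃[ n₀ ] ∀ (n : ℕ) → n₀ ≤ n → r ∣ n → ∀ (G : Digraph n) →
      (∀ (x y : Fin n) → ¬ (x ≡ y) → adj G x y ≡ false →
        ((ι 2) ℚ./ 1) ℚ.* ((ℚ.1ℚ ℚ.- ((ι 1) ℚ./ r)) ℚ.+ η) ℚ.* ((ι n) ℚ./ 1)
          ℚ.≤ ((ι (outdeg G x + indeg G y)) ℚ./ 1)) →
      HasTTFactor G r
  transitive-tournament-factor (suc k) (s≤s 0<k) (mkℚ (ι suc p) q cop) _ =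
    proj₁ cleared , λ n n₀≤n r∣n G deg →
      proj₂ cleared n (quotient r∣n) n₀≤n (trans (_∣_.equality r∣n) (*-comm (quotient r∣n) (suc k))) G λ x y x≢y x↛y →
        clear-denominators k p q cop n (quotient r∣n) (outdeg G x + indeg G y)
          (trans (_∣_.equality r∣n) (*-comm (quotient r∣n) (suc k))) (deg x y x≢y x↛y)
    where cleared = factor-of-cleared-condition k 0<k q p

open import Data.Nat using (ℕ; _≤_; NonZero)
open import Data.Nat.Divisibility using (_∣_)
open import Data.Integer using (+_)
open import Data.Rational using (ℚ; Positive; _/_; _*_; _+_; _-_; 1ℚ) renaming (_≤_ to _≤ℚ_)
open import Data.Fin using (Fin)
open import Data.Bool using (false)
open import Data.Product using (∃-syntax)
open import Relation.Binary.PropositionalEquality using (_≡_)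
open import Relation.Nullary using (¬_)

theorem1p10 : ∀ (r : ℕ) .{{_ : NonZero r}} → 2 ≤ r → ∀ (η : ℚ) → Positive η →
    ∃[ n₀ ] ∀ (n : ℕ) → n₀ ≤ n → r ∣ n → ∀ (G : Digraph n) →
    (∀ (x y : Fin n) → ¬ (x ≡ y) → adj G x y ≡ false →
    ((+ 2) / 1) * ((1ℚ - ((+ 1) / r)) + η) * ((+ n) / 1)
    ≤ℚ ((+ (outdeg G x Data.Nat.+ indeg G y)) / 1)) →
    HasTTFactor G r
theorem1p10 r = TransitiveTilings.transitive-tournament-factor r
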